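{- Let $A$ and $B$ be disjoint finite point sets in the plane with $|A|=|B|=n$ such that every $AB$-line contains at most three points of $A\cup B$. Then the bivisibility graph $\mathcal{B}(A,B)$ contains a non-crossing spanning tree.
   Context: An $AB$-line is a line containing at least one point of $A$ and at least one point of $B$. The bivisibility graph $\mathcal{B}(A,B)$ has vertex set $A\cup B$, where $v\in A$ and $w\in B$ are adjacent iff no point of $A\cup B$ lies in the open segment $vw$. Edges are drawn as straight segments; a subgraph is non-crossing if no two of its edges intersect except at a common endpoint. -}

module Defs where

open import Level using (Level; _⊔_; suc)
open import Algebra.Bundles using (CommutativeRing)
open import Relation.Binary.Core using (Rel)
open import Relation.Binary.Structures using (IsStrictTotalOrder)
open import Data.Nat using (ℕ)
open import Data.Fin using (Fin)
open import Data.Sum using (_⊎_; inj₁; inj₂)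
open import Data.Product using (_×_; _,_; proj₁; proj₂; ∃; Σ)
open import Data.List using (List)
open import Data.List.Membership.Propositional using (_∈_)
open import Relation.Nullary using (¬_)
open import Data.Empty using (⊥)
open import Relation.Binary.PropositionalEquality using (_≡_; _≢_)
open import Function using (Injective)

-- The plane is K², K an ordered field (ℝ being the intended instance).

record OrderedField (c ℓ : Level) : Set (suc (c ⊔ ℓ)) where
  field
    commutativeRing : CommutativeRing c ℓ
  open CommutativeRing commutativeRing public
  field
    _<_               : Rel Carrier ℓ
    isStrictTotalOrder : IsStrictTotalOrder _≈_ _<_
    0<1               : 0# < 1#
    +-mono-<          : ∀ {x y} z → x < y → (x + z) < (y + z)
    *-pos             : ∀ {x y} → 0# < x → 0# < y → 0# < (x * y)
    inverse           : ∀ x → ¬ (x ≈ 0#) → ∃ λ y → (x * y) ≈ 1#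

  _≤_ : Rel Carrier ℓ
  x ≤ y = (x < y) ⊎ (x ≈ y)

module Plane {c ℓ : Level} (K : OrderedField c ℓ) where
  open OrderedField K

  Point : Set c
  Point = Carrier × Carrier

  _≈P_ : Point → Point → Set ℓ
  p ≈P q = (proj₁ p ≈ proj₁ q) × (proj₂ p ≈ proj₂ q)

  interp : Point → Point → Carrier → Point
  interp u v t = (proj₁ u + t * (proj₁ v - proj₁ u)) , (proj₂ u + t * (proj₂ v - proj₂ u))

  InClosedSeg : Point → Point → Point → Set (c ⊔ ℓ)
  InClosedSeg p u v = ∃ λ t → (0# ≤ t) × (t ≤ 1#) × (p ≈P interp u v t)

  -- p lies in the open segment (u, v)  (u ≠ v in all uses below)
  InOpenSeg : Point → Point → Point → Set (c ⊔ ℓ)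
  InOpenSeg p u v = ∃ λ t → (0# < t) × (t < 1#) × (p ≈P interp u v t)

  -- p lies on the line through u and v  (u ≠ v in all uses below)
  OnLine : Point → Point → Point → Set (c ⊔ ℓ)
  OnLine p u v = ∃ λ t → p ≈P interp u v t

  module Config {n : ℕ} (A B : Fin n → Point) where

    Vertex : Set
    Vertex = Fin n ⊎ Fin n

    pos : Vertex → Point
    pos (inj₁ i) = A i
    pos (inj₂ j) = B j

    Distinct : Set ℓ
    Distinct = (∀ i j → A i ≈P A j → i ≡ j) × (∀ i j → B i ≈P B j → i ≡ j)

    Disjoint : Set ℓ
    Disjoint = ∀ i j → ¬ (A i ≈P B j)

    AtMostThreeOnABLines : Set (c ⊔ ℓ)
    AtMostThreeOnABLines =
      ∀ i j (v₁ v₂ v₃ v₄ : Vertex) →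
      v₁ ≢ v₂ → v₁ ≢ v₃ → v₁ ≢ v₄ → v₂ ≢ v₃ → v₂ ≢ v₄ → v₃ ≢ v₄ →
      OnLine (pos v₁) (A i) (B j) → OnLine (pos v₂) (A i) (B j) →
      OnLine (pos v₃) (A i) (B j) → OnLine (pos v₄) (A i) (B j) → ⊥

    Edge : Set
    Edge = Fin n × Fin n

    Bivisible : Edge → Set (c ⊔ ℓ)
    Bivisible (i , j) = ∀ v → ¬ InOpenSeg (pos v) (A i) (B j)

    data Reach {p : Level} (P : Edge → Set p) : Vertex → Vertex → Set p where
      here  : ∀ {v} → Reach P v v
      stepᵃᵇ : ∀ {i j w} → P (i , j) → Reach P (inj₂ j) w → Reach P (inj₁ i) w
      stepᵇᵃ : ∀ {i j w} → P (i , j) → Reach P (inj₁ i) w → Reach P (inj₂ j) w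

    -- T (a finite edge set) is a spanning tree of the bivisibility graph:
    -- its edges are bivisibility edges, it connects all vertices, and it
    -- is acyclic (every edge is a bridge: removing it disconnects its ends)
    IsSpanningTree : List Edge → Set (c ⊔ ℓ)
    IsSpanningTree T =
      (∀ {e} → e ∈ T → Bivisible e) ×
      (∀ u v → Reach (λ e → e ∈ T) u v) ×
      (∀ {i j} → (i , j) ∈ T →
         ¬ Reach (λ e → (e ∈ T) × (e ≢ (i , j))) (inj₁ i) (inj₂ j))

    EndpointOf : Vertex → Edge → Set
    EndpointOf v (i , j) = (v ≡ inj₁ i) ⊎ (v ≡ inj₂ j)

    NonCrossing : List Edge → Set (c ⊔ ℓ)
    NonCrossing T =
      ∀ {e f} → e ∈ T → f ∈ T → e ≢ f →
      ∀ (p : Point) → InClosedSeg p (A (proj₁ e)) (B (proj₂ e)) →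
                      InClosedSeg p (A (proj₁ f)) (B (proj₂ f)) →
      Σ Vertex λ v → EndpointOf v e × EndpointOf v f × (p ≈P pos v)

{-# OPTIONS --safe #-}

-- Induction on n.  Let a be a vertex of maximal norm, so that all other vertices lie strictly in an
-- open half plane bounded by a line through a, and sweep a ray about a.  Counting each vertex of
-- the colour opposite to a as +1 and each other vertex ≠ a as -1, the total is +1, so some ray lifts
-- the partial sum from ≤ 0 to ≥ 1.  As its line carries at most three vertices, that ray contains
-- exactly one vertex b, or two vertices b, b′ with b nearer to a, all of the colour opposite to a.
-- In both cases the two closed sides of the line ab, with b′ assigned to one of them, are balanced
-- configurations meeting in a and b; if both are smaller, the union of the two graphs obtained by
-- induction is connected and non-crossing.  Otherwise one open side of the line ab is empty:
-- delete a and b, and reconnect them by ab and an edge from a or b to a vertex c at which a line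
-- separating {a, b} from the rest supports the rest; c sees whichever of a, b has the other colour.
-- Finally a spanning tree of the connected graph is extracted.

module Submission where

open import Defs
open import Level using (Level; _⊔_)
open import Data.Nat using (ℕ)
open import Data.Fin using (Fin)
open import Data.Product using (_×_; Σ)
open import Data.List using (List)

open import Algebra.Bundles using (CommutativeRing; RawRing)
open import Algebra.Solver.Ring.AlmostCommutativeRing using (_-Raw-AlmostCommutative⟶_; fromCommutativeRing)
import Algebra.Solver.Ring as RingSolver
import Algebra.Properties.Semiring.Mult.TCOptimised as Mult
import Algebra.Properties.Ring as RingProperties
import Algebra.Properties.AbelianGroup as AbelianGroupProperties
open import Data.Bool as Bool using (Bool; true; false)
open import Data.Empty using (⊥; ⊥-elim)
import Data.Fin as Fin
open import Data.Integer as ℤ using (ℤ; +_; -[1+_]; _⊖_)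
import Data.Integer.Properties as ℤₚ
open import Data.List using ([]; _∷_; _++_; length; map; allFin)
import Data.List.Properties as Listₚ
open import Data.List.Membership.Propositional using (_∈_)
open import Data.List.Membership.Propositional.Properties
  using (∈-++⁺ˡ; ∈-++⁺ʳ; ∈-++⁻; ∈-∃++; ∈-map⁺; ∈-map⁻; ∈-allFin)
open import Data.List.Relation.Binary.Permutation.Propositional as Perm
  using (_↭_; ↭-refl; ↭-sym; ↭-trans; ↭-prep; ↭-reflexive; ↭⇒↭ₛ)
open import Data.List.Relation.Binary.Permutation.Propositional.Properties
  using (∈-resp-↭; ↭-length; shift; shifts; ++⁺ʳ; ++⁺ˡ; ++-comm)
import Data.List.Relation.Binary.Permutation.Setoid.Properties as Permₛ
open import Data.List.Relation.Unary.All as All using (All; []; _∷_)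
import Data.List.Relation.Unary.All.Properties as Allₚ
open import Data.List.Relation.Unary.AllPairs as AllPairs using ([]; _∷_)
open import Data.List.Relation.Unary.Any using (here; there)
open import Data.List.Relation.Unary.Unique.Propositional using (Unique)
import Data.List.Relation.Unary.Unique.Propositional.Properties as Uniqueₚ
open import Data.Maybe using (Maybe; just; nothing)
open import Data.Nat as ℕ using (zero; suc)
import Data.Nat.Properties as ℕₚ
open import Data.Product using (_,_; proj₁; proj₂)
open import Data.Sum using (_⊎_; inj₁; inj₂; [_,_]′)
import Data.Sum.Properties as Sumₚ
open import Relation.Binary.Definitions using (tri<; tri≈; tri>)
import Relation.Binary.PropositionalEquality as ≡
open ≡ using (_≡_; _≢_)
import Relation.Binary.Reasoning.Setoid as SetoidReasoning
open import Relation.Binary.Structures using (IsStrictTotalOrder)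
open import Relation.Nullary using (¬_; yes; no)
open import Relation.Nullary.Decidable using (Dec; map′; _×-dec_; _⊎-dec_)

-- The obstacle is visibility: an edge found in a subconfiguration could be blocked by a vertex left
-- out of it. Vertices strictly across the line `ab` cannot block, so only that line matters. In the
-- part containing `b′`, the nearer `b` hides `b′` from `a`, so the only possible edge on the line
-- is `ab`; in the other part `b′` does not block `ab`, because it lies beyond `b`.
--
-- A ray with two vertices lifts the partial sum by two, from 0 to 2 or from -1 to 1. The value
-- before the jump decides which side needs `b′` for balance.
--
-- The induction carries connected graphs, since two trees sharing `a` and `b` may have a cycle in
-- their union.
--
-- Maximal norm replaces a convex hull: the tangent at `a` to the circle about the origin leaves all
-- other vertices strictly on one side, so the angular order about `a` is the order of a quotient in
-- `K`. Incidences are settled by affine functions: one that reaches a bound for its end values at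
-- an inner point of a segment equals that bound at both ends.

-- A ring solver with integer coefficients.

module IntegerCoefficients {c ℓ : Level} (R : CommutativeRing c ℓ) where
  open CommutativeRing R
  open RingProperties ring using (-‿distribˡ-*; -‿distribʳ-*)
  open AbelianGroupProperties +-abelianGroup using (⁻¹-∙-comm; ⁻¹-involutive; ε⁻¹≈ε)
  open Mult semiring using (×-homo-+; ×1-homo-*; 1+×) renaming (_×_ to _·_)
  open SetoidReasoning setoid

  -- With the optimised multiple, `⟦ + 1 ⟧ℤ` reduces to `1#`, so `con (+ 1)` stands literally for
  -- `1#` in solver goals.
  ⟦_⟧ℤ : ℤ → Carrier
  ⟦ + n ⟧ℤ      = n · 1#
  ⟦ -[1+ n ] ⟧ℤ = - (suc n · 1#)

  cancel-1# : ∀ x y → (1# + x) + - (1# + y) ≈ x + - y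
  cancel-1# x y = begin
    (1# + x) + - (1# + y)     ≈⟨ +-cong (+-comm 1# x) (sym (⁻¹-∙-comm 1# y)) ⟩
    (x + 1#) + (- 1# + - y)   ≈⟨ +-assoc x 1# _ ⟩
    x + (1# + (- 1# + - y))   ≈⟨ +-congˡ (sym (+-assoc 1# _ _)) ⟩
    x + ((1# + - 1#) + - y)   ≈⟨ +-congˡ (+-congʳ (-‿inverseʳ 1#)) ⟩
    x + (0# + - y)            ≈⟨ +-congˡ (+-identityˡ _) ⟩
    x + - y                   ∎

  ⊖-homo : ∀ m n → ⟦ m ⊖ n ⟧ℤ ≈ m · 1# + - (n · 1#)
  ⊖-homo zero    zero    = sym (-‿inverseʳ 0#)
  ⊖-homo zero    (suc n) = sym (+-identityˡ _)
  ⊖-homo (suc m) zero    = sym (trans (+-congˡ ε⁻¹≈ε) (+-identityʳ _))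
  ⊖-homo (suc m) (suc n) = begin
    ⟦ suc m ⊖ suc n ⟧ℤ                 ≡⟨ ≡.cong ⟦_⟧ℤ (ℤₚ.[1+m]⊖[1+n]≡m⊖n m n) ⟩
    ⟦ m ⊖ n ⟧ℤ                         ≈⟨ ⊖-homo m n ⟩
    m · 1# + - (n · 1#)                ≈⟨ cancel-1# _ _ ⟨
    (1# + m · 1#) + - (1# + n · 1#)    ≈⟨ +-cong (1+× m 1#) (-‿cong (1+× n 1#)) ⟨
    suc m · 1# + - (suc n · 1#)        ∎

  +ℤ-homo : ∀ i j → ⟦ i ℤ.+ j ⟧ℤ ≈ ⟦ i ⟧ℤ + ⟦ j ⟧ℤ
  +ℤ-homo (+ m)      (+ n)      = ×-homo-+ 1# m n
  +ℤ-homo (+ m)      -[1+ n ]   = ⊖-homo m (suc n)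
  +ℤ-homo -[1+ m ]   (+ n)      = trans (⊖-homo n (suc m)) (+-comm _ _)
  +ℤ-homo -[1+ m ]   -[1+ n ]   = begin
    - (suc (suc (m ℕ.+ n)) · 1#)           ≡⟨ ≡.cong (λ k → - (suc k · 1#)) (≡.sym (ℕₚ.+-suc m n)) ⟩
    - ((suc m ℕ.+ suc n) · 1#)             ≈⟨ -‿cong (×-homo-+ 1# (suc m) (suc n)) ⟩
    - (suc m · 1# + suc n · 1#)            ≈⟨ ⁻¹-∙-comm _ _ ⟨
    - (suc m · 1#) + - (suc n · 1#)        ∎

  -ℤ-homo : ∀ i → ⟦ ℤ.- i ⟧ℤ ≈ - ⟦ i ⟧ℤ
  -ℤ-homo (+ zero)  = sym ε⁻¹≈ε
  -ℤ-homo (+ suc n) = refl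
  -ℤ-homo -[1+ n ]  = sym (⁻¹-involutive _)

  *ℤ-homo-+ : ∀ m n → ⟦ + m ℤ.* + n ⟧ℤ ≈ m · 1# * n · 1#
  *ℤ-homo-+ m n = begin
    ⟦ + m ℤ.* + n ⟧ℤ ≡⟨ ≡.cong ⟦_⟧ℤ (≡.sym (ℤₚ.pos-* m n)) ⟩
    (m ℕ.* n) · 1#   ≈⟨ ×1-homo-* m n ⟩
    m · 1# * n · 1#  ∎

  *ℤ-homo : ∀ i j → ⟦ i ℤ.* j ⟧ℤ ≈ ⟦ i ⟧ℤ * ⟦ j ⟧ℤ
  *ℤ-homo (+ m)    (+ n)    = *ℤ-homo-+ m n
  *ℤ-homo (+ m)    -[1+ n ] = begin
    ⟦ + m ℤ.* -[1+ n ] ⟧ℤ              ≡⟨ ≡.cong ⟦_⟧ℤ (≡.sym (ℤₚ.neg-distribʳ-* (+ m) (+ suc n))) ⟩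
    ⟦ ℤ.- (+ m ℤ.* + suc n) ⟧ℤ         ≈⟨ -ℤ-homo (+ m ℤ.* + suc n) ⟩
    - ⟦ + m ℤ.* + suc n ⟧ℤ             ≈⟨ -‿cong (*ℤ-homo-+ m (suc n)) ⟩
    - (m · 1# * suc n · 1#)            ≈⟨ -‿distribʳ-* _ _ ⟩
    m · 1# * - (suc n · 1#)            ∎
  *ℤ-homo -[1+ m ] (+ n)    = begin
    ⟦ -[1+ m ] ℤ.* + n ⟧ℤ              ≡⟨ ≡.cong ⟦_⟧ℤ (≡.sym (ℤₚ.neg-distribˡ-* (+ suc m) (+ n))) ⟩
    ⟦ ℤ.- (+ suc m ℤ.* + n) ⟧ℤ         ≈⟨ -ℤ-homo (+ suc m ℤ.* + n) ⟩
    - ⟦ + suc m ℤ.* + n ⟧ℤ             ≈⟨ -‿cong (*ℤ-homo-+ (suc m) n) ⟩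
    - (suc m · 1# * n · 1#)            ≈⟨ -‿distribˡ-* _ _ ⟩
    - (suc m · 1#) * n · 1#            ∎
  *ℤ-homo -[1+ m ] -[1+ n ] = begin
    (suc m ℕ.* suc n) · 1#             ≈⟨ ×1-homo-* (suc m) (suc n) ⟩
    suc m · 1# * suc n · 1#            ≈⟨ ⁻¹-involutive _ ⟨
    - - (suc m · 1# * suc n · 1#)      ≈⟨ -‿cong (-‿distribˡ-* _ _) ⟩
    - (- (suc m · 1#) * suc n · 1#)    ≈⟨ -‿distribʳ-* _ _ ⟩
    - (suc m · 1#) * - (suc n · 1#)    ∎

  ℤ-rawRing : RawRing _ _
  ℤ-rawRing = record
    { Carrier = ℤ ; _≈_ = _≡_ ; _+_ = ℤ._+_ ; _*_ = ℤ._*_ ; -_ = ℤ.-_ ; 0# = + 0 ; 1# = + 1 }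

  homomorphism : ℤ-rawRing -Raw-AlmostCommutative⟶ fromCommutativeRing R
  homomorphism = record
    { ⟦_⟧ = ⟦_⟧ℤ ; +-homo = +ℤ-homo ; *-homo = *ℤ-homo ; -‿homo = -ℤ-homo
    ; 0-homo = refl ; 1-homo = refl }

  -- A one-sided test: distinct integers may have equal images in a general `R`, so `nothing`
  -- asserts no inequality.
  coeff≟ : ∀ i j → Maybe (⟦ i ⟧ℤ ≈ ⟦ j ⟧ℤ)
  coeff≟ i j with i ℤ.≟ j
  ... | yes ≡.refl = just refl
  ... | no  _      = nothing

  open RingSolver ℤ-rawRing (fromCommutativeRing R) homomorphism coeff≟ public
    using (solve; _:=_; _:+_; _:*_; _:-_; :-_; con)

-- Arithmetic of ordered fields.

module OrderedFieldProperties {c ℓ : Level} (K : OrderedField c ℓ) where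
  open OrderedField K
  open IntegerCoefficients commutativeRing
  open IsStrictTotalOrder isStrictTotalOrder public
    using (compare; irrefl) renaming (trans to <-trans; <-resp-≈ to <-respʳˡ)

  <-respˡ : ∀ {x y z} → x ≈ y → x < z → y < z
  <-respˡ = proj₂ <-respʳˡ

  <-respʳ : ∀ {x y z} → y ≈ z → x < y → x < z
  <-respʳ = proj₁ <-respʳˡ

  <-irrefl : ∀ {x} → ¬ (x < x)
  <-irrefl = irrefl refl

  0<y-x : ∀ {x y} → x < y → 0# < (y - x)
  0<y-x {x} {y} x<y = <-respˡ (-‿inverseʳ x) (+-mono-< (- x) x<y)

  0<y-x⇒x<y : ∀ {x y} → 0# < (y - x) → x < y
  0<y-x⇒x<y {x} {y} h = <-respˡ (+-identityˡ x)
    (<-respʳ (solve 2 (λ x y → (y :- x) :+ x := y) refl x y) (+-mono-< x h))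

  +-pos : ∀ {x y} → 0# < x → 0# < y → 0# < (x + y)
  +-pos {x} {y} 0<x 0<y = <-trans 0<y (<-respˡ (+-identityˡ y) (+-mono-< y 0<x))

  ≤⇒≯ : ∀ {x y} → x ≤ y → ¬ (y < x)
  ≤⇒≯ (inj₁ x<y) y<x = <-irrefl (<-trans x<y y<x)
  ≤⇒≯ (inj₂ x≈y) y<x = irrefl (sym x≈y) y<x

  ≤-refl : ∀ {x} → x ≤ x
  ≤-refl = inj₂ refl

  ≤-reflexive : ∀ {x y} → x ≈ y → x ≤ y
  ≤-reflexive = inj₂

  <-≤-trans : ∀ {x y z} → x < y → y ≤ z → x < z
  <-≤-trans x<y (inj₁ y<z) = <-trans x<y y<z
  <-≤-trans x<y (inj₂ y≈z) = <-respʳ y≈z x<y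

  ≤-<-trans : ∀ {x y z} → x ≤ y → y < z → x < z
  ≤-<-trans (inj₁ x<y) y<z = <-trans x<y y<z
  ≤-<-trans (inj₂ x≈y) y<z = <-respˡ (sym x≈y) y<z

  ≤-trans : ∀ {x y z} → x ≤ y → y ≤ z → x ≤ z
  ≤-trans (inj₁ x<y) y≤z = inj₁ (<-≤-trans x<y y≤z)
  ≤-trans (inj₂ x≈y) (inj₁ y<z) = inj₁ (<-respˡ (sym x≈y) y<z)
  ≤-trans (inj₂ x≈y) (inj₂ y≈z) = inj₂ (trans x≈y y≈z)

  ≤-antisym : ∀ {x y} → x ≤ y → y ≤ x → x ≈ y
  ≤-antisym (inj₂ x≈y) _ = x≈y
  ≤-antisym (inj₁ x<y) y≤x = ⊥-elim (≤⇒≯ y≤x x<y)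

  0<-x : ∀ {x} → x < 0# → 0# < (- x)
  0<-x x<0 = <-respʳ (+-identityˡ _) (0<y-x x<0)

  -x<0 : ∀ {x} → 0# < x → (- x) < 0#
  -x<0 {x} 0<x = 0<y-x⇒x<y (<-respʳ (solve 1 (λ x → x := con (+ 0) :- (:- x)) refl x) 0<x)

  0<x*x : ∀ {x} → ¬ (x ≈ 0#) → 0# < (x * x)
  0<x*x {x} x≉0 with compare 0# x
  ... | tri< 0<x _ _ = *-pos 0<x 0<x
  ... | tri≈ _ 0≈x _ = ⊥-elim (x≉0 (sym 0≈x))
  ... | tri> _ _ x<0 = <-respʳ (solve 1 (λ x → :- x :* :- x := x :* x) refl x) (*-pos (0<-x x<0) (0<-x x<0))

  0≤x*x : ∀ x → 0# ≤ (x * x)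
  0≤x*x x with compare x 0#
  ... | tri< _ x≉0 _ = inj₁ (0<x*x x≉0)
  ... | tri≈ _ x≈0 _ = inj₂ (sym (trans (*-congʳ x≈0) (zeroˡ x)))
  ... | tri> _ x≉0 _ = inj₁ (0<x*x x≉0)

  *-cancelˡ-0 : ∀ {x y} → 0# < x → (x * y) ≈ 0# → y ≈ 0#
  *-cancelˡ-0 {x} {y} 0<x xy≈0 with compare y 0#
  ... | tri< y<0 _ _ = ⊥-elim (irrefl (sym (trans (solve 2 (λ x y → x :* :- y := :- (x :* y)) refl x y)
                               (trans (-‿cong xy≈0) (solve 0 (:- con (+ 0) := con (+ 0)) refl))))
                               (*-pos 0<x (0<-x y<0)))
  ... | tri≈ _ y≈0 _ = y≈0
  ... | tri> _ _ 0<y = ⊥-elim (irrefl (sym xy≈0) (*-pos 0<x 0<y))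

  *-cancelˡ-pos : ∀ {x y} → 0# < x → 0# < (x * y) → 0# < y
  *-cancelˡ-pos {x} {y} 0<x 0<xy with compare 0# y
  ... | tri< 0<y _ _ = 0<y
  ... | tri≈ _ 0≈y _ = ⊥-elim (irrefl (sym (trans (*-congˡ (sym 0≈y)) (zeroʳ x))) 0<xy)
  ... | tri> _ _ y<0 = ⊥-elim (<-irrefl (<-trans 0<xy (0<y-x⇒x<y
                         (<-respʳ (solve 2 (λ x y → x :* :- y := con (+ 0) :- x :* y) refl x y)
                           (*-pos 0<x (0<-x y<0))))))

  *-cancelˡ-< : ∀ {x y z} → 0# < x → (x * y) < (x * z) → y < z
  *-cancelˡ-< {x} {y} {z} 0<x xy<xz = 0<y-x⇒x<y (*-cancelˡ-pos 0<x
    (<-respʳ (solve 3 (λ x y z → x :* z :- x :* y := x :* (z :- y)) refl x y z) (0<y-x xy<xz)))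

  *-monoˡ-< : ∀ {x y z} → 0# < x → y < z → (x * y) < (x * z)
  *-monoˡ-< {x} {y} {z} 0<x y<z = 0<y-x⇒x<y
    (<-respʳ (solve 3 (λ x y z → x :* (z :- y) := x :* z :- x :* y) refl x y z) (*-pos 0<x (0<y-x y<z)))

  -- Only positive arguments are inverted; elsewhere the value 0# is junk.
  recip : Carrier → Carrier
  recip x with compare 0# x
  ... | tri< _ 0≉x _ = proj₁ (inverse x λ x≈0 → 0≉x (sym x≈0))
  ... | tri≈ _ _ _   = 0#
  ... | tri> _ _ _   = 0#

  *-recip : ∀ {x} → 0# < x → (x * recip x) ≈ 1#
  *-recip {x} 0<x with compare 0# x
  ... | tri< _ 0≉x _ = proj₂ (inverse x λ x≈0 → 0≉x (sym x≈0))
  ... | tri≈ 0≮x _ _ = ⊥-elim (0≮x 0<x)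
  ... | tri> 0≮x _ _ = ⊥-elim (0≮x 0<x)

  recip-pos : ∀ {x} → 0# < x → 0# < recip x
  recip-pos 0<x = *-cancelˡ-pos 0<x (<-respʳ (sym (*-recip 0<x)) 0<1)

  *-recip-cancel : ∀ {x} y → 0# < x → (x * (y * recip x)) ≈ y
  *-recip-cancel {x} y 0<x = trans (solve 3 (λ x y r → x :* (y :* r) := y :* (x :* r)) refl x y (recip x))
    (trans (*-congˡ (*-recip 0<x)) (*-identityʳ y))

  ≤⇒0≤ : ∀ {x y} → x ≤ y → 0# ≤ (y - x)
  ≤⇒0≤ (inj₁ x<y) = inj₁ (0<y-x x<y)
  ≤⇒0≤ {x} (inj₂ x≈y) = inj₂ (sym (trans (+-congʳ (sym x≈y)) (-‿inverseʳ x)))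

  ≤⇒≤0 : ∀ {x y} → x ≤ y → (x - y) ≤ 0#
  ≤⇒≤0 {x} {y} (inj₁ x<y) = inj₁ (<-respʳ (-‿inverseʳ y) (+-mono-< (- y) x<y))
  ≤⇒≤0 {x} {y} (inj₂ x≈y) = inj₂ (trans (+-congʳ x≈y) (-‿inverseʳ y))

  x-y≈0⇒x≈y : ∀ {x y} → (x - y) ≈ 0# → x ≈ y
  x-y≈0⇒x≈y {x} {y} e = trans (solve 2 (λ x y → x := (x :- y) :+ y) refl x y) (trans (+-congʳ e) (+-identityˡ y))

  neg-mono-≤ : ∀ {x y} → x ≤ y → (- y) ≤ (- x)
  neg-mono-≤ {x} {y} (inj₁ x<y) = inj₁ (0<y-x⇒x<y (<-respʳ (solve 2 (λ x y → y :- x := :- x :- :- y) refl x y) (0<y-x x<y)))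
  neg-mono-≤ (inj₂ x≈y) = inj₂ (-‿cong (sym x≈y))

  neg-cancel : ∀ {x y} → (- x) ≈ (- y) → x ≈ y
  neg-cancel {x} {y} e = trans (solve 1 (λ x → x := :- (:- x)) refl x)
    (trans (-‿cong e) (solve 1 (λ x → :- (:- x) := x) refl y))

  neg-cancel-≤ : ∀ {x y} → (- x) ≤ (- y) → y ≤ x
  neg-cancel-≤ {x} {y} (inj₁ lt) = inj₁ (0<y-x⇒x<y (<-respʳ (solve 2 (λ x y → :- y :- :- x := x :- y) refl x y) (0<y-x lt)))
  neg-cancel-≤ (inj₂ eq) = inj₂ (sym (neg-cancel eq))

  x≈0⇒-x≈0 : ∀ {x} → x ≈ 0# → (- x) ≈ 0#
  x≈0⇒-x≈0 e = trans (-‿cong e) (solve 0 (:- con (+ 0) := con (+ 0)) refl)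

  +-nonNeg-pos : ∀ {x y} → 0# ≤ x → 0# < y → 0# < (x + y)
  +-nonNeg-pos (inj₁ 0<x) 0<y = +-pos 0<x 0<y
  +-nonNeg-pos (inj₂ 0≈x) 0<y = <-respʳ (trans (sym (+-identityˡ _)) (+-congʳ 0≈x)) 0<y

  sum-squares-pos : ∀ {x y} → ¬ (x ≈ 0# × y ≈ 0#) → 0# < (x * x + y * y)
  sum-squares-pos {x} {y} ≉ with compare y 0#
  ... | tri< _ y≉0 _ = +-nonNeg-pos (0≤x*x x) (0<x*x y≉0)
  ... | tri> _ y≉0 _ = +-nonNeg-pos (0≤x*x x) (0<x*x y≉0)
  ... | tri≈ _ y≈0 _ = <-respʳ (+-comm _ _) (+-nonNeg-pos (0≤x*x y) (0<x*x (λ x≈0 → ≉ (x≈0 , y≈0))))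

-- Affine functions on segments.

module PlaneGeometry {c ℓ : Level} (K : OrderedField c ℓ) where
  open OrderedField K
  open OrderedFieldProperties K
  open IntegerCoefficients commutativeRing
  open Plane K

  -- Stated through interpolation instead of coefficients: this is the form in which segments use
  -- it, and it already contains invariance under `_≈P_` (`affine-cong`).
  IsAffine : (Point → Carrier) → Set (c ⊔ ℓ)
  IsAffine f = ∀ u v t p → p ≈P interp u v t → f p ≈ (f u + t * (f v - f u))

  affine-x : IsAffine proj₁
  affine-x u v t p (p≈ , _) = p≈

  affine-y : IsAffine proj₂
  affine-y u v t p (_ , p≈) = p≈

  affine-comb : ∀ {f g} μ ν κ → IsAffine f → IsAffine g → IsAffine (λ p → (μ * f p + ν * g p) + κ)
  affine-comb {f} {g} μ ν κ F G u v t p p≈ =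
    trans (+-congʳ (+-cong (*-congˡ (F u v t p p≈)) (*-congˡ (G u v t p p≈))))
      (solve 8 (λ μ ν κ t fu fv gu gv →
          μ :* (fu :+ t :* (fv :- fu)) :+ ν :* (gu :+ t :* (gv :- gu)) :+ κ :=
          ((μ :* fu :+ ν :* gu) :+ κ) :+ t :* (((μ :* fv :+ ν :* gv) :+ κ) :- ((μ :* fu :+ ν :* gu) :+ κ)))
        refl μ ν κ t (f u) (f v) (g u) (g v))

  affine-neg : ∀ {f} → IsAffine f → IsAffine (λ p → - f p)
  affine-neg {f} F u v t p p≈ = trans (-‿cong (F u v t p p≈))
    (solve 3 (λ t fu fv → :- (fu :+ t :* (fv :- fu)) := :- fu :+ t :* (:- fv :- :- fu)) refl t (f u) (f v))

  norm² : Point → Carrier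
  norm² p = proj₁ p * proj₁ p + proj₂ p * proj₂ p

  ≈P-sym : ∀ {p q} → p ≈P q → q ≈P p
  ≈P-sym (x , y) = sym x , sym y

  ≈P-trans : ∀ {p q r} → p ≈P q → q ≈P r → p ≈P r
  ≈P-trans (x , y) (x′ , y′) = trans x x′ , trans y y′

  interp-0 : ∀ u v {t} → t ≈ 0# → interp u v t ≈P u
  interp-0 u v t≈0 = at (proj₁ u) (proj₁ v) , at (proj₂ u) (proj₂ v)
    where
    at : ∀ x y → (x + _ * (y - x)) ≈ x
    at x y = trans (+-congˡ (*-congʳ t≈0)) (solve 2 (λ x y → x :+ con (+ 0) :* (y :- x) := x) refl x y)

  interp-1 : ∀ u v {t} → t ≈ 1# → interp u v t ≈P v
  interp-1 u v t≈1 = at (proj₁ u) (proj₁ v) , at (proj₂ u) (proj₂ v)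
    where
    at : ∀ x y → (x + _ * (y - x)) ≈ y
    at x y = trans (+-congˡ (*-congʳ t≈1)) (solve 2 (λ x y → x :+ con (+ 1) :* (y :- x) := y) refl x y)

  interp-swap : ∀ u v t → interp u v t ≈P interp v u (1# - t)
  interp-swap u v t = at (proj₁ u) (proj₁ v) , at (proj₂ u) (proj₂ v)
    where
    at : ∀ x y → (x + t * (y - x)) ≈ (y + (1# - t) * (x - y))
    at x y = solve 3 (λ t x y → x :+ t :* (y :- x) := y :+ (con (+ 1) :- t) :* (x :- y)) refl t x y

  -- Any point equal to `q` is an interpolation on the degenerate segment from `q` to `q`.
  affine-cong : ∀ {f} → IsAffine f → ∀ {p q} → p ≈P q → f p ≈ f q
  affine-cong {f} F {p} {q} p≈q = trans
    (F q q 0# p (≈P-trans p≈q (≈P-sym (interp-0 q q refl))))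
    (solve 1 (λ x → x :+ con (+ 0) :* (x :- x) := x) refl (f q))

  OnLine-sym : ∀ {p u v} → OnLine p u v → OnLine p v u
  OnLine-sym {p} {u} {v} (t , p≈) = 1# - t , ≈P-trans p≈ (interp-swap u v t)

  InOpenSeg-sym : ∀ {p u v} → InOpenSeg p u v → InOpenSeg p v u
  InOpenSeg-sym {p} {u} {v} (t , 0<t , t<1 , p≈) =
    1# - t , 0<y-x t<1 ,
    0<y-x⇒x<y (<-respʳ (solve 1 (λ t → t := con (+ 1) :- (con (+ 1) :- t)) refl t) 0<t) ,
    ≈P-trans p≈ (interp-swap u v t)

  closed-cases : ∀ {p u v} → InClosedSeg p u v → p ≈P u ⊎ p ≈P v ⊎ InOpenSeg p u v
  closed-cases {p} {u} {v} (t , inj₂ 0≈t , _ , p≈)            = inj₁ (≈P-trans p≈ (interp-0 u v (sym 0≈t)))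
  closed-cases {p} {u} {v} (t , inj₁ 0<t , inj₂ t≈1 , p≈)     = inj₂ (inj₁ (≈P-trans p≈ (interp-1 u v t≈1)))
  closed-cases {p} {u} {v} (t , inj₁ 0<t , inj₁ t<1 , p≈)     = inj₂ (inj₂ (t , 0<t , t<1 , p≈))

  open⇒closed : ∀ {p u v} → InOpenSeg p u v → InClosedSeg p u v
  open⇒closed (t , 0<t , t<1 , p≈) = t , inj₁ 0<t , inj₁ t<1 , p≈

  InOpenSeg-cong : ∀ {p q u v} → p ≈P q → InOpenSeg p u v → InOpenSeg q u v
  InOpenSeg-cong p≈q (t , 0<t , t<1 , p≈) = t , 0<t , t<1 , ≈P-trans (≈P-sym p≈q) p≈

  -- The value is `(1# - t) * x + t * y` with both weights positive, so a single positive value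
  -- among `x` and `y` would make it positive.
  convex-pos : ∀ {t x y} → 0# < t → t < 1# → 0# ≤ x → 0# ≤ y → (x + t * (y - x)) ≤ 0# → (x ≈ 0#) × (y ≈ 0#)
  convex-pos {t} {x} {y} 0<t t<1 (inj₁ 0<x) 0≤y le = ⊥-elim (≤⇒≯ le (<-respʳ
    (solve 3 (λ t x y → (con (+ 1) :- t) :* x :+ t :* y := x :+ t :* (y :- x)) refl t x y) (go 0≤y)))
    where
    go : 0# ≤ y → 0# < ((1# - t) * x + t * y)
    go (inj₁ 0<y) = +-pos (*-pos (0<y-x t<1) 0<x) (*-pos 0<t 0<y)
    go (inj₂ 0≈y) = <-respʳ (sym (trans (+-congˡ (trans (*-congˡ (sym 0≈y)) (zeroʳ t))) (+-identityʳ _)))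
                            (*-pos (0<y-x t<1) 0<x)
  convex-pos {t} {x} {y} 0<t t<1 (inj₂ 0≈x) (inj₂ 0≈y) le = sym 0≈x , sym 0≈y
  convex-pos {t} {x} {y} 0<t t<1 (inj₂ 0≈x) (inj₁ 0<y) le = ⊥-elim (≤⇒≯ le (<-respʳ
    (trans (solve 2 (λ t y → t :* y := con (+ 0) :+ t :* (y :- con (+ 0))) refl t y)
           (+-cong 0≈x (*-congˡ (+-congˡ (-‿cong 0≈x))))) (*-pos 0<t 0<y)))

  -- The basic tool of the later geometry: a segment on one side of the line `f = m` that reaches
  -- this line at an inner point lies in it.
  open-min : ∀ {f} → IsAffine f → ∀ {p u v m} → InOpenSeg p u v → m ≤ f u → m ≤ f v → f p ≤ m →
             (f u ≈ m) × (f v ≈ m)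
  open-min {f} F {p} {u} {v} {m} (t , 0<t , t<1 , p≈) mu mv pm =
    let e₁ , e₂ = convex-pos 0<t t<1 (≤⇒0≤ mu) (≤⇒0≤ mv) (≤-trans (≤-reflexive
          (trans (solve 4 (λ t a b m → (a :- m) :+ t :* ((b :- m) :- (a :- m)) := (a :+ t :* (b :- a)) :- m) refl t (f u) (f v) m)
                 (+-congʳ (sym (F u v t p p≈))))) (≤⇒≤0 pm))
    in x-y≈0⇒x≈y e₁ , x-y≈0⇒x≈y e₂

  open-max : ∀ {f} → IsAffine f → ∀ {p u v m} → InOpenSeg p u v → f u ≤ m → f v ≤ m → m ≤ f p →
             (f u ≈ m) × (f v ≈ m)
  open-max {f} F {p} {u} {v} {m} o mu mv pm =
    let e₁ , e₂ = open-min {λ q → - f q} (affine-neg F) {p} {u} {v} {(- m)} o (neg-mono-≤ mu) (neg-mono-≤ mv) (neg-mono-≤ pm)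
    in neg-cancel e₁ , neg-cancel e₂

-- Edges against a line bounding a half plane.

module Drawing {c ℓ : Level} (K : OrderedField c ℓ) {n : ℕ} (A B : Fin n → Plane.Point K) where
  open OrderedField K
  open OrderedFieldProperties K
  open Plane K
  open PlaneGeometry K
  open Config A B

  On : Point → Edge → Set (c ⊔ ℓ)
  On p (i , j) = InClosedSeg p (A i) (B j)

  Inside : Point → Edge → Set (c ⊔ ℓ)
  Inside p (i , j) = InOpenSeg p (A i) (B j)

  EndsSatisfy : ∀ {a} → (Vertex → Set a) → Edge → Set a
  EndsSatisfy P e = ∀ {v} → EndpointOf v e → P v

  module _ {f : Point → Carrier} (F : IsAffine f) where

    Inside-min : ∀ {p e m} → Inside p e → EndsSatisfy (λ v → m ≤ f (pos v)) e → f p ≤ m →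
                 EndsSatisfy (λ v → f (pos v) ≈ m) e
    Inside-min o lo pm (inj₁ ≡.refl) = proj₁ (open-min F o (lo (inj₁ ≡.refl)) (lo (inj₂ ≡.refl)) pm)
    Inside-min o lo pm (inj₂ ≡.refl) = proj₂ (open-min F o (lo (inj₁ ≡.refl)) (lo (inj₂ ≡.refl)) pm)

    Inside-max : ∀ {p e m} → Inside p e → EndsSatisfy (λ v → f (pos v) ≤ m) e → m ≤ f p →
                 EndsSatisfy (λ v → f (pos v) ≈ m) e
    Inside-max o lo pm (inj₁ ≡.refl) = proj₁ (open-max F o (lo (inj₁ ≡.refl)) (lo (inj₂ ≡.refl)) pm)
    Inside-max o lo pm (inj₂ ≡.refl) = proj₂ (open-max F o (lo (inj₁ ≡.refl)) (lo (inj₂ ≡.refl)) pm)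

  -- A segment on one side of the line `f = m` meets it at an end or lies in it entirely; in the
  -- second case nothing is known about the position of `p` on the edge.
  TouchesAt : (Point → Carrier) → Carrier → Point → Edge → Set ℓ
  TouchesAt f m p e = (Σ Vertex λ v → EndpointOf v e × (p ≈P pos v) × (f (pos v) ≈ m))
                    ⊎ EndsSatisfy (λ v → f (pos v) ≈ m) e

  On-cases : ∀ {p e} → On p e → (Σ Vertex λ v → EndpointOf v e × (p ≈P pos v)) ⊎ Inside p e
  On-cases {p} {i , j} o with closed-cases o
  ... | inj₁ p≈       = inj₁ (inj₁ i , inj₁ ≡.refl , p≈)
  ... | inj₂ (inj₁ p≈) = inj₁ (inj₂ j , inj₂ ≡.refl , p≈)
  ... | inj₂ (inj₂ q) = inj₂ q

  module _ {f : Point → Carrier} (F : IsAffine f) where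

    On-min : ∀ {p e m} → On p e → EndsSatisfy (λ v → m ≤ f (pos v)) e → f p ≤ m → TouchesAt f m p e
    On-min {p} {e} o lo pm with On-cases o
    ... | inj₁ (v , ve , p≈) = inj₁ (v , ve , p≈ , ≤-antisym (≤-trans (≤-reflexive (affine-cong F (≈P-sym p≈))) pm) (lo ve))
    ... | inj₂ q = inj₂ (Inside-min F {e = e} q lo pm)

    On-max : ∀ {p e m} → On p e → EndsSatisfy (λ v → f (pos v) ≤ m) e → m ≤ f p → TouchesAt f m p e
    On-max {p} {e} o lo pm with On-cases o
    ... | inj₁ (v , ve , p≈) = inj₁ (v , ve , p≈ , ≤-antisym (lo ve) (≤-trans pm (≤-reflexive (affine-cong F p≈))))
    ... | inj₂ q = inj₂ (Inside-max F {e = e} q lo pm)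

    On-≥ : ∀ {p e m} → On p e → EndsSatisfy (λ v → m ≤ f (pos v)) e → m ≤ f p
    On-≥ {p} {e} {m} o lo with compare m (f p)
    ... | tri< a _ _ = inj₁ a
    ... | tri≈ _ b _ = inj₂ b
    ... | tri> _ _ fp<m with On-cases o
    ...   | inj₁ (v , ve , p≈) = ⊥-elim (≤⇒≯ (lo ve) (<-respˡ (affine-cong F p≈) fp<m))
    -- `f p` is itself a lower bound for the ends, so an inner point would give both ends this
    -- value, which is below `m`.
    ...   | inj₂ q = ⊥-elim (≤⇒≯ (≤-reflexive (Inside-min F {e = e} q (λ ve → ≤-trans (inj₁ fp<m) (lo ve)) ≤-refl (inj₁ ≡.refl)))
                             (<-≤-trans fp<m (lo (inj₁ ≡.refl))))

    On-≤ : ∀ {p e m} → On p e → EndsSatisfy (λ v → f (pos v) ≤ m) e → f p ≤ m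
    On-≤ {p} {e} {m} o hi with compare (f p) m
    ... | tri< a _ _ = inj₁ a
    ... | tri≈ _ b _ = inj₂ b
    ... | tri> _ _ m<fp with On-cases o
    ...   | inj₁ (v , ve , p≈) = ⊥-elim (≤⇒≯ (hi ve) (<-respʳ (affine-cong F p≈) m<fp))
    ...   | inj₂ q = ⊥-elim (≤⇒≯ (≤-reflexive (sym (Inside-max F {e = e} q (λ ve → ≤-trans (hi ve) (inj₁ m<fp)) ≤-refl (inj₁ ≡.refl))))
                             (≤-<-trans (hi (inj₁ ≡.refl)) m<fp))

-- Connected plane graphs: gluing along a line and attaching an edge.

module PlaneGraphs {c ℓ : Level} (K : OrderedField c ℓ) {n : ℕ} (A B : Fin n → Plane.Point K)
  (pos-injective : ∀ {u v} → Plane._≈P_ K (Plane.Config.pos K A B u) (Plane.Config.pos K A B v) → u ≡ v) where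
  open OrderedField K
  open OrderedFieldProperties K
  open Plane K
  open Config A B
  open PlaneGeometry K
  open Drawing K A B

  side : Vertex → Bool
  side (inj₁ _) = true
  side (inj₂ _) = false

  -- An edge stores its `A` end first, while the extreme vertex may have either colour; this
  -- relation forgets the orientation.
  Joins : Edge → Vertex → Vertex → Set
  Joins (i , j) u v = (u ≡ inj₁ i × v ≡ inj₂ j) ⊎ (u ≡ inj₂ j × v ≡ inj₁ i)

  join : ∀ u v → side u ≢ side v → Σ Edge λ e → Joins e u v
  join (inj₁ i) (inj₁ _) ≢ = ⊥-elim (≢ ≡.refl)
  join (inj₁ i) (inj₂ j) ≢ = (i , j) , inj₁ (≡.refl , ≡.refl)
  join (inj₂ j) (inj₁ i) ≢ = (i , j) , inj₂ (≡.refl , ≡.refl)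
  join (inj₂ j) (inj₂ _) ≢ = ⊥-elim (≢ ≡.refl)

  Joins-end₁ : ∀ {e u v} → Joins e u v → EndpointOf u e
  Joins-end₁ (inj₁ (p , _)) = inj₁ p
  Joins-end₁ (inj₂ (p , _)) = inj₂ p

  Joins-end₂ : ∀ {e u v} → Joins e u v → EndpointOf v e
  Joins-end₂ (inj₁ (_ , q)) = inj₂ q
  Joins-end₂ (inj₂ (_ , q)) = inj₁ q

  Joins-ends : ∀ {e u v a} {P : Vertex → Set a} → Joins e u v → P u → P v → EndsSatisfy P e
  Joins-ends (inj₁ (≡.refl , ≡.refl)) Pu Pv (inj₁ ≡.refl) = Pu
  Joins-ends (inj₁ (≡.refl , ≡.refl)) Pu Pv (inj₂ ≡.refl) = Pv
  Joins-ends (inj₂ (≡.refl , ≡.refl)) Pu Pv (inj₁ ≡.refl) = Pv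
  Joins-ends (inj₂ (≡.refl , ≡.refl)) Pu Pv (inj₂ ≡.refl) = Pu

  Joins-unique : ∀ {e f u v} → Joins e u v → Joins f u v → e ≡ f
  Joins-unique (inj₁ (≡.refl , ≡.refl)) (inj₁ (≡.refl , ≡.refl)) = ≡.refl
  Joins-unique (inj₁ (≡.refl , _)) (inj₂ (() , _))
  Joins-unique (inj₂ (≡.refl , _)) (inj₁ (() , _))
  Joins-unique (inj₂ (≡.refl , ≡.refl)) (inj₂ (≡.refl , ≡.refl)) = ≡.refl

  Joins-Inside : ∀ {e u v p} → Joins e u v → Inside p e → InOpenSeg p (pos u) (pos v)
  Joins-Inside (inj₁ (≡.refl , ≡.refl)) o = o
  Joins-Inside (inj₂ (≡.refl , ≡.refl)) o = InOpenSeg-sym o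

  Inside-Joins : ∀ {e u v p} → Joins e u v → InOpenSeg p (pos u) (pos v) → Inside p e
  Inside-Joins (inj₁ (≡.refl , ≡.refl)) o = o
  Inside-Joins (inj₂ (≡.refl , ≡.refl)) o = InOpenSeg-sym o

  -- An edge has ends of both colours, and all listed vertices other than `a` have the colour of
  -- `b`, so one end is `a`.
  Joins-within : ∀ {a b} (E : List Vertex) → side a ≢ side b → All (λ v → side v ≡ side b) E →
                 ∀ {e} → EndsSatisfy (_∈ (a ∷ b ∷ E)) e →
                 Joins e a b ⊎ (Σ Vertex λ v → v ∈ E × Joins e a v)
  Joins-within {a} {b} E a≢b Eb {i , j} ends with ends (inj₁ ≡.refl) | ends (inj₂ ≡.refl)
  ... | here ≡.refl         | here ()
  ... | here p              | there (here q)      = inj₁ (inj₁ (≡.sym p , ≡.sym q))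
  ... | here p              | there (there q)     = inj₂ (_ , q , inj₁ (≡.sym p , ≡.refl))
  ... | there (here p)      | here q              = inj₁ (inj₂ (≡.sym q , ≡.sym p))
  ... | there (there p)     | here q              = inj₂ (_ , p , inj₂ (≡.sym q , ≡.refl))
  ... | there p             | there q             = ⊥-elim (true≢false (≡.trans (sb p) (≡.sym (sb q))))
    where
    true≢false : true ≢ false
    true≢false ()
    sb : ∀ {v} → v ∈ (b ∷ E) → side v ≡ side b
    sb (here ≡.refl) = ≡.refl
    sb (there v∈) = All.lookup Eb v∈

  Reach-trans : ∀ {p} {P : Edge → Set p} {u v w} → Reach P u v → Reach P v w → Reach P u w
  Reach-trans here s = s
  Reach-trans (stepᵃᵇ e r) s = stepᵃᵇ e (Reach-trans r s)
  Reach-trans (stepᵇᵃ e r) s = stepᵇᵃ e (Reach-trans r s)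

  Reach-sym : ∀ {p} {P : Edge → Set p} {u v} → Reach P u v → Reach P v u
  Reach-sym here = here
  Reach-sym (stepᵃᵇ e r) = Reach-trans (Reach-sym r) (stepᵇᵃ e here)
  Reach-sym (stepᵇᵃ e r) = Reach-trans (Reach-sym r) (stepᵃᵇ e here)

  Reach-map : ∀ {p q} {P : Edge → Set p} {Q : Edge → Set q} → (∀ {e} → P e → Q e) →
              ∀ {u v} → Reach P u v → Reach Q u v
  Reach-map f here = here
  Reach-map f (stepᵃᵇ e r) = stepᵃᵇ (f e) (Reach-map f r)
  Reach-map f (stepᵇᵃ e r) = stepᵇᵃ (f e) (Reach-map f r)

  Reach-join : ∀ {p} {P : Edge → Set p} {e u v} → Joins e u v → P e → Reach P u v
  Reach-join (inj₁ (≡.refl , ≡.refl)) Pe = stepᵃᵇ Pe here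
  Reach-join (inj₂ (≡.refl , ≡.refl)) Pe = stepᵇᵃ Pe here

  MeetAtEnds : Edge → Edge → Set (c ⊔ ℓ)
  MeetAtEnds e f = ∀ p → On p e → On p f → Σ Vertex λ v → EndpointOf v e × EndpointOf v f × (p ≈P pos v)

  MeetAtEnds-sym : ∀ {e f} → MeetAtEnds e f → MeetAtEnds f e
  MeetAtEnds-sym m p pf pe = let v , ve , vf , p≈ = m p pe pf in v , vf , ve , p≈

  -- Blocking is excluded for vertices of `S` only, so each enlargement of `S` has to check the
  -- added vertices against the old edges.
  record ConnectedPlaneGraph (S : List Vertex) : Set (c ⊔ ℓ) where
    field
      edges       : List Edge
      within      : ∀ {e} → e ∈ edges → EndsSatisfy (_∈ S) e
      bivisible   : ∀ {e} → e ∈ edges → ∀ {v} → v ∈ S → ¬ Inside (pos v) e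
      connected   : ∀ {u v} → u ∈ S → v ∈ S → Reach (_∈ edges) u v
      nonCrossing : NonCrossing edges

  open ConnectedPlaneGraph

  resp-⊆⊇ : ∀ {S S′} → (∀ {v} → v ∈ S → v ∈ S′) → (∀ {v} → v ∈ S′ → v ∈ S) →
            ConnectedPlaneGraph S → ConnectedPlaneGraph S′
  resp-⊆⊇ to from G = record
    { edges       = edges G
    ; within      = λ e∈ ve → to (within G e∈ ve)
    ; bivisible   = λ e∈ v∈ → bivisible G e∈ (from v∈)
    ; connected   = λ u∈ v∈ → connected G (from u∈) (from v∈)
    ; nonCrossing = nonCrossing G
    }

  -- If `u` were an inner point, each coordinate would take an extreme value there and hence agree
  -- at both ends.
  open-irreflˡ : ∀ {u v} → u ≢ v → ¬ InOpenSeg (pos u) (pos u) (pos v)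
  open-irreflˡ {u} {v} u≢v o = u≢v (pos-injective (same affine-x , same affine-y))
    where
    same : ∀ {f} → IsAffine f → f (pos u) ≈ f (pos v)
    same {f} F with compare (f (pos u)) (f (pos v))
    ... | tri< lt _ _ = sym (proj₂ (open-min F o ≤-refl (inj₁ lt) ≤-refl))
    ... | tri≈ _ eq _ = eq
    ... | tri> _ _ gt = sym (proj₂ (open-max F o ≤-refl (inj₁ gt) ≤-refl))

  open-irreflʳ : ∀ {u v} → u ≢ v → ¬ InOpenSeg (pos v) (pos u) (pos v)
  open-irreflʳ u≢v o = open-irreflˡ (λ e → u≢v (≡.sym e)) (InOpenSeg-sym o)

  Beyond : Vertex → Vertex → Vertex → Set (c ⊔ ℓ)
  Beyond a b v = side v ≡ side b × InOpenSeg (pos b) (pos a) (pos v)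

  module _ {a b : Vertex} (a≢b : side a ≢ side b) where

    private
      a≠b : a ≢ b
      a≠b e = a≢b (≡.cong side e)

    -- In a coordinate that separates `a` from `b`, whichever of `b` and `v` is farther out would be
    -- an inner point of a segment whose ends do not go past it.
    ¬open-beyond : ∀ {v} → Beyond a b v → ¬ InOpenSeg (pos v) (pos a) (pos b)
    ¬open-beyond {v} (_ , bo) vo = a≠b (pos-injective (same affine-x , same affine-y))
      where
      same : ∀ {f} → IsAffine f → f (pos a) ≈ f (pos b)
      same {f} F with compare (f (pos a)) (f (pos b))
      ... | tri≈ _ eq _ = eq
      ... | tri< lt _ _ with compare (f (pos v)) (f (pos b))
      ...   | tri< vb _ _ = proj₁ (open-max F bo (inj₁ lt) (inj₁ vb) ≤-refl)
      ...   | tri≈ _ vb _ = proj₁ (open-max F bo (inj₁ lt) (inj₂ vb) ≤-refl)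
      ...   | tri> _ _ bv = proj₁ (open-max F vo (inj₁ lt) ≤-refl (inj₁ bv))
      same {f} F | tri> _ _ gt with compare (f (pos v)) (f (pos b))
      ...   | tri> _ _ vb = proj₁ (open-min F bo (inj₁ gt) (inj₁ vb) ≤-refl)
      ...   | tri≈ _ vb _ = proj₁ (open-min F bo (inj₁ gt) (inj₂ (sym vb)) ≤-refl)
      ...   | tri< bv _ _ = proj₁ (open-min F vo (inj₁ gt) ≤-refl (inj₁ bv))

    single-edge : ConnectedPlaneGraph (a ∷ b ∷ [])
    single-edge with join a b a≢b
    ... | e , ab = record
      { edges       = e ∷ []
      ; within      = λ { (here ≡.refl) → Joins-ends {P = _∈ (a ∷ b ∷ [])} ab (here ≡.refl) (there (here ≡.refl)) }
      ; bivisible   = λ { (here ≡.refl) (here ≡.refl) o → open-irreflˡ a≠b (Joins-Inside ab o)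
                        ; (here ≡.refl) (there (here ≡.refl)) o → open-irreflʳ a≠b (Joins-Inside ab o) }
      ; connected   = conn
      ; nonCrossing = λ { (here ≡.refl) (here ≡.refl) e≢e → ⊥-elim (e≢e ≡.refl) }
      }
      where
      ab-reach : Reach (_∈ (e ∷ [])) a b
      ab-reach = Reach-join ab (here ≡.refl)
      conn : ∀ {u v} → u ∈ (a ∷ b ∷ []) → v ∈ (a ∷ b ∷ []) → Reach (_∈ (e ∷ [])) u v
      conn (here ≡.refl) (here ≡.refl) = here
      conn (here ≡.refl) (there (here ≡.refl)) = ab-reach
      conn (there (here ≡.refl)) (here ≡.refl) = Reach-sym ab-reach
      conn (there (here ≡.refl)) (there (here ≡.refl)) = here

    module Along {E : List Vertex} (beyond : All (Beyond a b) E) {f : Point → Carrier} (F : IsAffine f)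
                 (fa : f (pos a) ≈ 0#) (fb : f (pos b) ≈ 0#) (fE : All (λ v → f (pos v) ≈ 0#) E) where

      -- The sign of `f` keeps the two graphs apart off the line, and on the line both can only use
      -- the same edge `ab`.
      merge : ∀ {X Y} → All (λ v → 0# < f (pos v)) X → All (λ v → f (pos v) < 0#) Y →
              ConnectedPlaneGraph (a ∷ b ∷ E ++ X) → ConnectedPlaneGraph (a ∷ b ∷ Y) →
              ConnectedPlaneGraph (a ∷ b ∷ E ++ X ++ Y)
      merge {X} {Y} X>0 Y<0 G H = record
        { edges       = edges G ++ edges H
        ; within      = λ e∈ ve → [ (λ e∈G → G⊆ (within G e∈G ve)) , (λ e∈H → H⊆ (within H e∈H ve)) ]′ (∈-++⁻ (edges G) e∈)
        ; bivisible   = λ e∈ v∈ → [ (λ e∈G → bivisible-G e∈G (cases v∈)) , (λ e∈H → bivisible-H e∈H (cases v∈)) ]′ (∈-++⁻ (edges G) e∈)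
        ; connected   = λ u∈ v∈ → Reach-trans (to-a (cases u∈)) (Reach-sym (to-a (cases v∈)))
        ; nonCrossing = λ {e} {e′} e∈ e′∈ e≢e′ → crossing (∈-++⁻ (edges G) e∈) (∈-++⁻ (edges G) e′∈) e≢e′
        }
        where
        H⊆ : ∀ {v} → v ∈ (a ∷ b ∷ Y) → v ∈ (a ∷ b ∷ E ++ X ++ Y)
        H⊆ (here p) = here p
        H⊆ (there (here p)) = there (here p)
        H⊆ (there (there v∈Y)) = there (there (∈-++⁺ʳ E (∈-++⁺ʳ X v∈Y)))

        G⊆ : ∀ {v} → v ∈ (a ∷ b ∷ E ++ X) → v ∈ (a ∷ b ∷ E ++ X ++ Y)
        G⊆ (here p) = here p
        G⊆ (there (here p)) = there (here p)
        G⊆ (there (there v∈)) with ∈-++⁻ E v∈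
        ... | inj₁ v∈E = there (there (∈-++⁺ˡ v∈E))
        ... | inj₂ v∈X = there (there (∈-++⁺ʳ E (∈-++⁺ˡ v∈X)))

        cases : ∀ {v} → v ∈ (a ∷ b ∷ E ++ X ++ Y) → v ∈ (a ∷ b ∷ E ++ X) ⊎ v ∈ Y
        cases (here p) = inj₁ (here p)
        cases (there (here p)) = inj₁ (there (here p))
        cases (there (there v∈)) with ∈-++⁻ E v∈
        ... | inj₁ v∈E = inj₁ (there (there (∈-++⁺ˡ v∈E)))
        ... | inj₂ v∈ with ∈-++⁻ X v∈
        ...   | inj₁ v∈X = inj₁ (there (there (∈-++⁺ʳ E v∈X)))
        ...   | inj₂ v∈Y = inj₂ v∈Y

        G≥0 : ∀ {v} → v ∈ (a ∷ b ∷ E ++ X) → (v ∈ (a ∷ b ∷ E) × f (pos v) ≈ 0#) ⊎ (0# < f (pos v))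
        G≥0 (here ≡.refl) = inj₁ (here ≡.refl , fa)
        G≥0 (there (here ≡.refl)) = inj₁ (there (here ≡.refl) , fb)
        G≥0 (there (there v∈)) with ∈-++⁻ E v∈
        ... | inj₁ v∈E = inj₁ (there (there v∈E) , All.lookup fE v∈E)
        ... | inj₂ v∈X = inj₂ (All.lookup X>0 v∈X)

        H≤0 : ∀ {v} → v ∈ (a ∷ b ∷ Y) → (v ∈ (a ∷ b ∷ []) × f (pos v) ≈ 0#) ⊎ (f (pos v) < 0#)
        H≤0 (here ≡.refl) = inj₁ (here ≡.refl , fa)
        H≤0 (there (here ≡.refl)) = inj₁ (there (here ≡.refl) , fb)
        H≤0 (there (there v∈)) = inj₂ (All.lookup Y<0 v∈)

        f≥0 : ∀ {e} → e ∈ edges G → EndsSatisfy (λ v → 0# ≤ f (pos v)) e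
        f≥0 e∈ ve with G≥0 (within G e∈ ve)
        ... | inj₁ (_ , f≈0) = inj₂ (sym f≈0)
        ... | inj₂ 0<f = inj₁ 0<f

        f≤0 : ∀ {e} → e ∈ edges H → EndsSatisfy (λ v → f (pos v) ≤ 0#) e
        f≤0 e∈ ve with H≤0 (within H e∈ ve)
        ... | inj₁ (_ , f≈0) = inj₂ f≈0
        ... | inj₂ f<0 = inj₁ f<0

        zero-G : ∀ {e v} → e ∈ edges G → EndpointOf v e → f (pos v) ≈ 0# → v ∈ (a ∷ b ∷ E)
        zero-G e∈ ve f≈0 with G≥0 (within G e∈ ve)
        ... | inj₁ (v∈ , _) = v∈
        ... | inj₂ 0<f = ⊥-elim (≤⇒≯ (≤-reflexive f≈0) 0<f)

        zero-H : ∀ {e v} → e ∈ edges H → EndpointOf v e → f (pos v) ≈ 0# → v ∈ (a ∷ b ∷ [])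
        zero-H e∈ ve f≈0 with H≤0 (within H e∈ ve)
        ... | inj₁ (v∈ , _) = v∈
        ... | inj₂ f<0 = ⊥-elim (≤⇒≯ (≤-reflexive (sym f≈0)) f<0)

        line-G : ∀ {e} → e ∈ edges G → EndsSatisfy (λ v → f (pos v) ≈ 0#) e → Joins e a b
        line-G e∈ f≈0 with Joins-within E a≢b (All.map proj₁ beyond) (λ ve → zero-G e∈ ve (f≈0 ve))
        ... | inj₁ ab = ab
        -- An edge from `a` into `E` would have `b` inside.
        ... | inj₂ (v , v∈E , av) = ⊥-elim (bivisible G e∈ (there (here ≡.refl))
                                      (Inside-Joins av (proj₂ (All.lookup beyond v∈E))))

        line-H : ∀ {e} → e ∈ edges H → EndsSatisfy (λ v → f (pos v) ≈ 0#) e → Joins e a b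
        line-H e∈ f≈0 with Joins-within [] a≢b [] (λ ve → zero-H e∈ ve (f≈0 ve))
        ... | inj₁ ab = ab

        bivisible-G : ∀ {e v} → e ∈ edges G → v ∈ (a ∷ b ∷ E ++ X) ⊎ v ∈ Y → ¬ Inside (pos v) e
        bivisible-G e∈ (inj₁ v∈) = bivisible G e∈ v∈
        bivisible-G {e} e∈ (inj₂ v∈) o = ≤⇒≯
          (On-≥ F {e = e} (open⇒closed o) (f≥0 e∈)) (All.lookup Y<0 v∈)

        bivisible-H : ∀ {e v} → e ∈ edges H → v ∈ (a ∷ b ∷ E ++ X) ⊎ v ∈ Y → ¬ Inside (pos v) e
        bivisible-H e∈ (inj₂ v∈) = bivisible H e∈ (there (there v∈))
        bivisible-H {e} e∈ (inj₁ v∈) o with v∈ | G≥0 v∈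
        ... | here p | _ = bivisible H e∈ (here p) o
        ... | there (here p) | _ = bivisible H e∈ (there (here p)) o
        ... | there (there v∈EX) | inj₂ 0<f = ≤⇒≯ (On-≤ F {e = e} (open⇒closed o) (f≤0 e∈)) 0<f
        ... | there (there v∈EX) | inj₁ (v∈abE , f≈0) = on-line v∈abE
          where
          -- `f` vanishes at an inner point, so the whole edge lies in the line and must be `ab`,
          -- which `E` does not block.
          ab : Joins e a b
          ab = line-H e∈ (Inside-max F {e = e} o (f≤0 e∈) (inj₂ (sym f≈0)))
          on-line : _ ∈ (a ∷ b ∷ E) → ⊥
          on-line (here p) = bivisible H e∈ (here p) o
          on-line (there (here p)) = bivisible H e∈ (there (here p)) o
          on-line (there (there v∈E)) = ¬open-beyond (All.lookup beyond v∈E) (Joins-Inside ab o)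

        to-a : ∀ {v} → v ∈ (a ∷ b ∷ E ++ X) ⊎ v ∈ Y → Reach (_∈ (edges G ++ edges H)) v a
        to-a (inj₁ v∈) = Reach-map ∈-++⁺ˡ (connected G v∈ (here ≡.refl))
        to-a (inj₂ v∈) = Reach-map (∈-++⁺ʳ (edges G)) (connected H (there (there v∈)) (here ≡.refl))

        ab-end : ∀ {e v} → Joins e a b → v ∈ (a ∷ b ∷ []) → EndpointOf v e
        ab-end ab (here ≡.refl) = Joins-end₁ ab
        ab-end ab (there (here ≡.refl)) = Joins-end₂ ab

        across : ∀ {e e′} → e ∈ edges G → e′ ∈ edges H → e ≢ e′ → MeetAtEnds e e′
        across {e} {e′} e∈ e′∈ e≢e′ p pe pe′
          with On-min F {e = e} pe (f≥0 e∈) (On-≤ F {e = e′} pe′ (f≤0 e′∈))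
             | On-max F {e = e′} pe′ (f≤0 e′∈) (On-≥ F {e = e} pe (f≥0 e∈))
        ... | inj₁ (v , ve , p≈ , _) | inj₁ (v′ , v′e′ , p≈′ , _) =
              v , ve , ≡.subst (λ x → EndpointOf x e′) (pos-injective (≈P-trans (≈P-sym p≈′) p≈)) v′e′ , p≈
        ... | inj₂ l | inj₂ l′ = ⊥-elim (e≢e′ (Joins-unique (line-G e∈ l) (line-H e′∈ l′)))
        ... | inj₂ l | inj₁ (v′ , v′e′ , p≈′ , f≈0) = v′ , ab-end (line-G e∈ l) (zero-H e′∈ v′e′ f≈0) , v′e′ , p≈′
        -- `v` may belong to `E` and then is no end of `ab`; `bivisible-H` excludes that it lies
        -- inside this edge.
        ... | inj₁ (v , ve , p≈ , f≈0) | inj₂ l′ with On-cases {e = e′} pe′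
        ...   | inj₁ (v′ , v′e′ , p≈′) = v , ve , ≡.subst (λ x → EndpointOf x e′) (pos-injective (≈P-trans (≈P-sym p≈′) p≈)) v′e′ , p≈
        ...   | inj₂ o = ⊥-elim (bivisible-H e′∈ (inj₁ (within G e∈ ve)) (InOpenSeg-cong p≈ o))

        crossing : ∀ {e e′} → e ∈ edges G ⊎ e ∈ edges H → e′ ∈ edges G ⊎ e′ ∈ edges H → e ≢ e′ → MeetAtEnds e e′
        crossing (inj₁ e∈) (inj₁ e′∈) ≢ = nonCrossing G e∈ e′∈ ≢
        crossing (inj₁ e∈) (inj₂ e′∈) ≢ = across e∈ e′∈ ≢
        crossing (inj₂ e∈) (inj₁ e′∈) ≢ = MeetAtEnds-sym (across e′∈ e∈ (λ p → ≢ (≡.sym p)))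
        crossing (inj₂ e∈) (inj₂ e′∈) ≢ = nonCrossing H e∈ e′∈ ≢

      -- Two separations cooperate. `f` keeps `a` and `b` out of the inside of the edge from `d` to
      -- `c`. `g` stays below `g (pos c)` on both new edges except at `c`, while all old vertices
      -- and edges are at or above this level.
      attach : ∀ {X c g} → IsAffine g → All (λ v → 0# < f (pos v)) X → c ∈ X →
               g (pos a) < g (pos c) → g (pos b) < g (pos c) → (∀ {v} → v ∈ (E ++ X) → g (pos c) ≤ g (pos v)) →
               ConnectedPlaneGraph (E ++ X) → ConnectedPlaneGraph (a ∷ b ∷ E ++ X)
      attach {X} {c} {g} G-aff X>0 c∈X ga<gc gb<gc gc≤ G
        with join a b a≢b | opposite
        where
        opposite : Σ Vertex λ d → d ∈ (a ∷ b ∷ []) × side d ≢ side c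
        opposite with side a Bool.≟ side c
        ... | no  a≢c = a , here ≡.refl , a≢c
        ... | yes a≡c = b , there (here ≡.refl) , λ b≡c → a≢b (≡.trans a≡c (≡.sym b≡c))
      ... | e₁ , ab | d , d∈ , d≢c with join d c d≢c
      ... | e₂ , dc = record
        { edges       = T
        ; within      = within′
        ; bivisible   = bivisible′
        ; connected   = λ u∈ v∈ → Reach-trans (to-a u∈) (Reach-sym (to-a v∈))
        ; nonCrossing = crossing
        }
        where
        T = e₁ ∷ e₂ ∷ edges G

        S = a ∷ b ∷ E ++ X

        fc>0 : 0# < f (pos c)
        fc>0 = All.lookup X>0 c∈X

        c∈EX : c ∈ (E ++ X)
        c∈EX = ∈-++⁺ʳ E c∈X

        ab⊆S : ∀ {v} → v ∈ (a ∷ b ∷ []) → v ∈ S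
        ab⊆S (here p) = here p
        ab⊆S (there (here p)) = there (here p)

        f-ab : ∀ {v} → v ∈ (a ∷ b ∷ []) → f (pos v) ≈ 0#
        f-ab (here ≡.refl) = fa
        f-ab (there (here ≡.refl)) = fb

        g-ab : ∀ {v} → v ∈ (a ∷ b ∷ []) → g (pos v) < g (pos c)
        g-ab (here ≡.refl) = ga<gc
        g-ab (there (here ≡.refl)) = gb<gc

        f-e₁ : EndsSatisfy (λ v → f (pos v) ≈ 0#) e₁
        f-e₁ = Joins-ends {P = λ v → f (pos v) ≈ 0#} ab fa fb

        g-e₁ : EndsSatisfy (λ v → g (pos v) < g (pos c)) e₁
        g-e₁ = Joins-ends {P = λ v → g (pos v) < g (pos c)} ab ga<gc gb<gc

        f-e₂ : EndsSatisfy (λ v → 0# ≤ f (pos v)) e₂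
        f-e₂ = Joins-ends {P = λ v → 0# ≤ f (pos v)} dc (inj₂ (sym (f-ab d∈))) (inj₁ fc>0)

        g-e₂ : EndsSatisfy (λ v → g (pos v) ≤ g (pos c)) e₂
        g-e₂ = Joins-ends {P = λ v → g (pos v) ≤ g (pos c)} dc (inj₁ (g-ab d∈)) ≤-refl

        g-old : ∀ {e} → e ∈ edges G → EndsSatisfy (λ v → g (pos c) ≤ g (pos v)) e
        g-old e∈ ve = gc≤ (within G e∈ ve)

        within′ : ∀ {e} → e ∈ T → EndsSatisfy (_∈ S) e
        within′ (here ≡.refl) = Joins-ends {P = _∈ S} ab (here ≡.refl) (there (here ≡.refl))
        within′ (there (here ≡.refl)) = Joins-ends {P = _∈ S} dc (ab⊆S d∈) (there (there c∈EX))
        within′ (there (there e∈)) ve = there (there (within G e∈ ve))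

        beneath : ∀ {e v} → e ∈ edges G → g (pos v) < g (pos c) → ¬ Inside (pos v) e
        beneath {e} e∈ gv<gc o = ≤⇒≯ (On-≥ G-aff {e = e} (open⇒closed o) (g-old e∈)) gv<gc

        on-base : ∀ {v} → v ∈ (a ∷ b ∷ []) → ¬ Inside (pos v) e₂
        on-base v∈ o = ≤⇒≯ (≤-reflexive (Inside-min F {e = e₂} o f-e₂ (≤-reflexive (f-ab v∈)) (Joins-end₂ dc))) fc>0

        bivisible′ : ∀ {e} → e ∈ T → ∀ {v} → v ∈ S → ¬ Inside (pos v) e
        bivisible′ (here ≡.refl) (here ≡.refl) o = open-irreflˡ a≠b (Joins-Inside ab o)
        bivisible′ (here ≡.refl) (there (here ≡.refl)) o = open-irreflʳ a≠b (Joins-Inside ab o)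
        bivisible′ (here ≡.refl) (there (there v∈)) o with ∈-++⁻ E v∈
        ... | inj₁ v∈E = ¬open-beyond (All.lookup beyond v∈E) (Joins-Inside ab o)
        ... | inj₂ v∈X = ≤⇒≯ (On-≤ F {e = e₁} (open⇒closed o) (λ ve → ≤-reflexive (f-e₁ ve))) (All.lookup X>0 v∈X)
        bivisible′ (there (here ≡.refl)) (here p) o = on-base (here p) o
        bivisible′ (there (here ≡.refl)) (there (here p)) o = on-base (there (here p)) o
        bivisible′ (there (here ≡.refl)) (there (there v∈)) o =
          irrefl (Inside-max G-aff {e = e₂} o g-e₂ (gc≤ v∈) (Joins-end₁ dc)) (g-ab d∈)
        bivisible′ (there (there e∈)) (here ≡.refl) = beneath {v = a} e∈ ga<gc
        bivisible′ (there (there e∈)) (there (here ≡.refl)) = beneath {v = b} e∈ gb<gc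
        bivisible′ (there (there e∈)) (there (there v∈)) = bivisible G e∈ v∈

        ab-reach : Reach (_∈ T) b a
        ab-reach = Reach-sym (Reach-join ab (here ≡.refl))

        d-reach : ∀ {v} → v ∈ (a ∷ b ∷ []) → Reach (_∈ T) v a
        d-reach (here ≡.refl) = here
        d-reach (there (here ≡.refl)) = ab-reach

        to-a : ∀ {v} → v ∈ S → Reach (_∈ T) v a
        to-a (here ≡.refl) = here
        to-a (there (here ≡.refl)) = ab-reach
        to-a (there (there v∈)) = Reach-trans (Reach-map (λ e∈ → there (there e∈)) (connected G v∈ c∈EX))
          (Reach-trans (Reach-sym (Reach-join dc (there (here ≡.refl)))) (d-reach d∈))

        meet₁₂ : MeetAtEnds e₁ e₂
        meet₁₂ p p₁ p₂ with On-min F {e = e₂} p₂ f-e₂ (On-≤ F {e = e₁} p₁ (λ ve → ≤-reflexive (f-e₁ ve)))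
        ... | inj₂ l = ⊥-elim (≤⇒≯ (≤-reflexive (l (Joins-end₂ dc))) fc>0)
        ... | inj₁ (v , ve , p≈ , f≈0) = v , Joins-ends {P = λ u → f (pos u) ≈ 0# → EndpointOf u e₁} dc
                (λ _ → d-end d∈) (λ fc≈0 → ⊥-elim (≤⇒≯ (≤-reflexive fc≈0) fc>0)) ve f≈0 , ve , p≈
          where
          d-end : ∀ {u} → u ∈ (a ∷ b ∷ []) → EndpointOf u e₁
          d-end (here ≡.refl) = Joins-end₁ ab
          d-end (there (here ≡.refl)) = Joins-end₂ ab

        meet₁ : ∀ {e} → e ∈ edges G → MeetAtEnds e₁ e
        meet₁ {e} e∈ p p₁ pe with On-max G-aff {e = e₁} p₁ (λ ve → inj₁ (g-e₁ ve)) (On-≥ G-aff {e = e} pe (g-old e∈))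
        ... | inj₁ (v , ve , _ , g≈) = ⊥-elim (irrefl g≈ (g-e₁ ve))
        ... | inj₂ l = ⊥-elim (irrefl (l (Joins-end₁ ab)) ga<gc)

        meet₂ : ∀ {e} → e ∈ edges G → MeetAtEnds e₂ e
        meet₂ {e} e∈ p p₂ pe with On-max G-aff {e = e₂} p₂ g-e₂ (On-≥ G-aff {e = e} pe (g-old e∈))
        ... | inj₂ l = ⊥-elim (irrefl (l (Joins-end₁ dc)) (g-ab d∈))
        ... | inj₁ (v , ve , p≈ , g≈) with Joins-ends {P = λ u → g (pos u) ≈ g (pos c) → u ≡ c} dc
                (λ gd≈ → ⊥-elim (irrefl gd≈ (g-ab d∈))) (λ _ → ≡.refl) ve g≈ | On-cases {e = e} pe
        ...   | v≡c | inj₁ (v′ , v′e , p≈′) =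
                  v , ve , ≡.subst (λ x → EndpointOf x e) (pos-injective (≈P-trans (≈P-sym p≈′) p≈)) v′e , p≈
        -- The common point is `c`, and no vertex of `E ++ X` lies inside an edge of `G`.
        ...   | ≡.refl | inj₂ o = ⊥-elim (bivisible G e∈ c∈EX (InOpenSeg-cong p≈ o))

        crossing : NonCrossing T
        crossing (here ≡.refl) (here ≡.refl) ≢ = ⊥-elim (≢ ≡.refl)
        crossing (here ≡.refl) (there (here ≡.refl)) ≢ = meet₁₂
        crossing (here ≡.refl) (there (there f∈)) ≢ = meet₁ f∈
        crossing (there (here ≡.refl)) (here ≡.refl) ≢ = MeetAtEnds-sym meet₁₂
        crossing (there (here ≡.refl)) (there (here ≡.refl)) ≢ = ⊥-elim (≢ ≡.refl)
        crossing (there (here ≡.refl)) (there (there f∈)) ≢ = meet₂ f∈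
        crossing (there (there e∈)) (here ≡.refl) ≢ = MeetAtEnds-sym (meet₁ e∈)
        crossing (there (there e∈)) (there (here ≡.refl)) ≢ = MeetAtEnds-sym (meet₂ e∈)
        crossing (there (there e∈)) (there (there f∈)) ≢ = nonCrossing G e∈ f∈ ≢

-- Lists without repetition and signed weights.

module _ {a} {V : Set a} where

  Unique-resp-↭ : ∀ {xs ys : List V} → xs ↭ ys → Unique xs → Unique ys
  Unique-resp-↭ p = Permₛ.Unique-resp-↭ (≡.setoid V) (↭⇒↭ₛ p)

  Unique-++⁻ˡ : ∀ (xs : List V) {ys} → Unique (xs ++ ys) → Unique xs
  Unique-++⁻ˡ []       u        = []
  Unique-++⁻ˡ (x ∷ xs) (x∉ ∷ u) = Allₚ.++⁻ˡ xs x∉ ∷ Unique-++⁻ˡ xs u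

  Unique-++⁻ʳ : ∀ (xs : List V) {ys} → Unique (xs ++ ys) → Unique ys
  Unique-++⁻ʳ []       u       = u
  Unique-++⁻ʳ (x ∷ xs) (_ ∷ u) = Unique-++⁻ʳ xs u

  extract : ∀ {x : V} {xs} → x ∈ xs → Σ (List V) λ ys → xs ↭ x ∷ ys
  extract x∈ with ys , zs , ≡.refl ← ∈-∃++ x∈ = ys ++ zs , shift _ ys zs

  module Weighted (weight : V → ℤ) where

    total : List V → ℤ
    total []       = + 0
    total (x ∷ xs) = weight x ℤ.+ total xs

    total-++ : ∀ xs ys → total (xs ++ ys) ≡ total xs ℤ.+ total ys
    total-++ []       ys = ≡.sym (ℤₚ.+-identityˡ _)
    total-++ (x ∷ xs) ys = ≡.trans (≡.cong (λ t → weight x ℤ.+ t) (total-++ xs ys)) (≡.sym (ℤₚ.+-assoc (weight x) _ _))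

    total-↭ : ∀ {xs ys} → xs ↭ ys → total xs ≡ total ys
    total-↭ Perm.refl = ≡.refl
    total-↭ (Perm.prep x p) = ≡.cong (λ t → weight x ℤ.+ t) (total-↭ p)
    total-↭ (Perm.swap {xs} {ys} x y p) = ≡.trans (≡.cong (λ t → weight x ℤ.+ (weight y ℤ.+ t)) (total-↭ p))
      (≡.trans (≡.sym (ℤₚ.+-assoc (weight x) (weight y) _))
      (≡.trans (≡.cong (ℤ._+ total ys) (ℤₚ.+-comm (weight x) (weight y)))
               (ℤₚ.+-assoc (weight y) (weight x) _)))
    total-↭ (Perm.trans p q) = ≡.trans (total-↭ p) (total-↭ q)

-- Sweeping by a key to a critical level.

module Sweep {c ℓ : Level} (K : OrderedField c ℓ) {a} {V : Set a} (key : V → OrderedField.Carrier K) where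
  open OrderedField K using (_≈_; _<_; _≤_; sym; trans)
  open OrderedFieldProperties K

  maximum : ∀ x xs → Σ V λ v → v ∈ (x ∷ xs) × (∀ {u} → u ∈ (x ∷ xs) → key u ≤ key v)
  maximum x [] = x , here ≡.refl , λ { (here ≡.refl) → ≤-refl }
  maximum x (y ∷ ys) with maximum y ys
  ... | v , v∈ , max with compare (key x) (key v)
  ...   | tri< lt _ _ = v , there v∈ , λ { (here ≡.refl) → inj₁ lt ; (there u∈) → max u∈ }
  ...   | tri≈ _ eq _ = v , there v∈ , λ { (here ≡.refl) → inj₂ eq ; (there u∈) → max u∈ }
  ...   | tri> _ _ gt = x , here ≡.refl , λ { (here ≡.refl) → ≤-refl ; (there u∈) → ≤-trans (max u∈) (inj₁ gt) }

  partition-top : ∀ p Q → (∀ {u} → u ∈ Q → key u ≤ key p) →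
                  Σ (List V) λ X → Σ (List V) λ Z → Q ↭ X ++ Z ×
                  All (λ v → key v < key p) X × All (λ v → key v ≈ key p) Z
  partition-top p [] max = [] , [] , ↭-refl , [] , []
  partition-top p (x ∷ Q) max with partition-top p Q (λ u∈ → max (there u∈)) | max (here ≡.refl)
  ... | X , Z , perm , X< , Z≈ | inj₁ lt = x ∷ X , Z , ↭-prep x perm , lt ∷ X< , Z≈
  ... | X , Z , perm , X< , Z≈ | inj₂ eq = X , x ∷ Z , ↭-trans (↭-prep x perm) (↭-sym (shift x X Z)) , X< , eq ∷ Z≈

  module _ (weight : V → ℤ) where
    open Weighted weight

    -- A discrete intermediate value: partial sums over increasing keys run from 0 to a positive
    -- total. The level `Z` is kept whole, because elements of equal key will lie on one ray.
    record CriticalLevel (Q : List V) : Set (a ⊔ ℓ ⊔ c) where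
      constructor level
      field
        {pivot}    : V
        pivot∈     : pivot ∈ Q
        X Z Y      : List V
        perm       : Q ↭ X ++ Z ++ Y
        below      : All (λ v → key v < key pivot) X
        at         : All (λ v → key v ≈ key pivot) Z
        above      : All (λ v → key pivot < key v) Y
        X≤0        : total X ℤ.≤ + 0
        1≤X+Z      : + 1 ℤ.≤ total X ℤ.+ total Z

    -- Split off the top level as long as the levels below it have positive total.
    criticalLevel : ∀ k Q → length Q ℕ.≤ k → + 1 ℤ.≤ total Q → CriticalLevel Q
    criticalLevel k [] _ (ℤ.+≤+ ())
    criticalLevel (suc k) (q ∷ Q) (ℕ.s≤s len) pos with maximum q Q
    ... | p , p∈ , max with partition-top p (q ∷ Q) max
    ...   | X , Z , perm , X< , Z≈ with total X ℤ.≤? + 0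
    ...     | yes X≤0 = level p∈ X Z [] (≡.subst (λ l → (q ∷ Q) ↭ X ++ l) (≡.sym (Listₚ.++-identityʳ Z)) perm)
                          X< Z≈ [] X≤0 (≡.subst (+ 1 ℤ.≤_) (≡.trans (total-↭ perm) (total-++ X Z)) pos)
    ...     | no X≰0 with criticalLevel k X (shorter Z perm p∈Z) (ℤₚ.i<j⇒suc[i]≤j (ℤₚ.≰⇒> X≰0))
      where
      p∈Z : p ∈ Z
      p∈Z with ∈-++⁻ X (∈-resp-↭ perm p∈)
      ... | inj₁ p∈X = ⊥-elim (<-irrefl (All.lookup X< p∈X))
      ... | inj₂ p∈Z = p∈Z
      -- The top level contains `p`, so dropping it shortens the list.
      shorter : ∀ Z → (q ∷ Q) ↭ X ++ Z → p ∈ Z → length X ℕ.≤ k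
      shorter (z ∷ Z) perm _ = ℕₚ.≤-trans (ℕₚ.≤-trans (ℕₚ.m≤m+n (length X) (length Z))
        (ℕₚ.≤-reflexive (ℕₚ.suc-injective (≡.trans (≡.sym (ℕₚ.+-suc (length X) (length Z)))
          (≡.trans (≡.sym (Listₚ.length-++ X)) (≡.sym (↭-length perm))))))) len
    ...       | level {r} r∈ X′ Z′ Y′ perm′ below at above X≤0 1≤ =
                level (∈-resp-↭ (↭-sym perm) (∈-++⁺ˡ r∈)) X′ Z′ (Y′ ++ Z)
                  (↭-trans perm (↭-trans (++⁺ʳ Z perm′)
                    (↭-reflexive (≡.trans (Listₚ.++-assoc X′ (Z′ ++ Y′) Z) (≡.cong (X′ ++_) (Listₚ.++-assoc Z′ Y′ Z))))))
                  below at
                  -- The split-off level lies above the new pivot, since `r` was found in `X`,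
                  -- strictly below `p`.
                  (Allₚ.++⁺ above (All.map (λ z≈p → <-respʳ (sym z≈p) (All.lookup X< r∈)) Z≈))
                  X≤0 1≤

-- Coordinates centred at a point of maximal norm.

module ExtremePoint {c ℓ : Level} (K : OrderedField c ℓ) (a : Plane.Point K) where
  open OrderedField K
  open OrderedFieldProperties K
  open IntegerCoefficients commutativeRing
  open Plane K
  open PlaneGeometry K

  private
    ax = proj₁ a
    ay = proj₂ a

  -- With d = p - a: depth p = - a · d and lateral p = a × d.
  depth lateral : Point → Carrier
  depth p   = ((- ax) * proj₁ p + (- ay) * proj₂ p) + norm² a
  lateral p = ((- ay) * proj₁ p + ax * proj₂ p) + 0#

  depth-affine : IsAffine depth
  depth-affine = affine-comb (- ax) (- ay) (norm² a) affine-x affine-y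

  lateral-affine : IsAffine lateral
  lateral-affine = affine-comb (- ay) ax 0# affine-x affine-y

  depth-a : depth a ≈ 0#
  depth-a = solve 2 (λ x y → (:- x :* x :+ :- y :* y) :+ (x :* x :+ y :* y) := con (+ 0)) refl ax ay

  lateral-a : lateral a ≈ 0#
  lateral-a = solve 2 (λ x y → (:- y :* x :+ x :* y) :+ con (+ 0) := con (+ 0)) refl ax ay

  -- 2 depth p = (|a|² - |p|²) + |a - p|²
  depth-pos : ∀ {p} → norm² p ≤ norm² a → ¬ (p ≈P a) → 0# < depth p
  depth-pos {p} le p≉a = *-cancelˡ-pos (+-pos 0<1 0<1) (<-respʳ
    (solve 4 (λ ax ay px py →
        ((ax :* ax :+ ay :* ay) :- (px :* px :+ py :* py)) :+ ((ax :- px) :* (ax :- px) :+ (ay :- py) :* (ay :- py)) :=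
        (con (+ 1) :+ con (+ 1)) :* ((:- ax :* px :+ :- ay :* py) :+ (ax :* ax :+ ay :* ay)))
      refl ax ay (proj₁ p) (proj₂ p))
    (+-nonNeg-pos (≤⇒0≤ le) (sum-squares-pos (λ { (x , y) → p≉a (sym (x-y≈0⇒x≈y x) , sym (x-y≈0⇒x≈y y)) }))))

  -- If `a` were the origin, `depth` would vanish identically.
  norm-pos : ∀ {p} → 0# < depth p → 0# < norm² a
  norm-pos {p} 0<d = sum-squares-pos λ { (x≈0 , y≈0) → irrefl (sym (vanish x≈0 y≈0)) 0<d }
    where
    vanish : ax ≈ 0# → ay ≈ 0# → depth p ≈ 0#
    vanish x≈0 y≈0 = trans
      (+-cong (+-cong (*-congʳ (-‿cong x≈0)) (*-congʳ (-‿cong y≈0))) (+-cong (*-cong x≈0 x≈0) (*-cong y≈0 y≈0)))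
      (solve 2 (λ x y → (:- con (+ 0) :* x :+ :- con (+ 0) :* y) :+ (con (+ 0) :* con (+ 0) :+ con (+ 0) :* con (+ 0)) := con (+ 0))
        refl (proj₁ p) (proj₂ p))

  -- |a|² d = - depth p · a + lateral p · a^⊥, so depth and lateral determine p.
  on-ray : ∀ {p q t μ} → 0# < depth q → lateral p ≈ (μ * depth p) → lateral q ≈ (μ * depth q) →
           (depth q * t) ≈ depth p → p ≈P interp a q t
  on-ray {p} {q} {t} {μ} 0<d lp lq dt = cx , cy
    where
    -- The second bracket equals `lateral q * t - lateral p`, rearranged so that each summand
    -- vanishes by one hypothesis.
    rest : ∀ α β → (α * (depth q * t - depth p) + β * ((lateral q - μ * depth q) * t + (μ * (depth q * t - depth p) - (lateral p - μ * depth p)))) ≈ 0#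
    rest α β = trans (+-cong (*-congˡ z₁) (*-congˡ (+-cong (*-congʳ (z lq)) (+-cong (*-congˡ z₁) (-‿cong (z lp))))))
      (solve 4 (λ α β t μ → α :* con (+ 0) :+ β :* (con (+ 0) :* t :+ (μ :* con (+ 0) :- con (+ 0))) := con (+ 0)) refl α β t μ)
      where
      z : ∀ {x y} → x ≈ y → (x - y) ≈ 0#
      z {x} {y} e = trans (+-congʳ e) (-‿inverseʳ y)
      z₁ = z dt
    cx : proj₁ p ≈ (ax + t * (proj₁ q - ax))
    cx = x-y≈0⇒x≈y (*-cancelˡ-0 (norm-pos {q} 0<d) (trans
      (solve 8 (λ ax ay px py qx qy t μ →
        let d = λ x y → (:- ax :* x :+ :- ay :* y) :+ (ax :* ax :+ ay :* ay)
            l = λ x y → (:- ay :* x :+ ax :* y) :+ con (+ 0) in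
        (ax :* ax :+ ay :* ay) :* (px :- (ax :+ t :* (qx :- ax))) :=
        ax :* (d qx qy :* t :- d px py) :+ ay :* ((l qx qy :- μ :* d qx qy) :* t :+ (μ :* (d qx qy :* t :- d px py) :- (l px py :- μ :* d px py))))
        refl ax ay (proj₁ p) (proj₂ p) (proj₁ q) (proj₂ q) t μ)
      (rest ax ay)))
    cy : proj₂ p ≈ (ay + t * (proj₂ q - ay))
    cy = x-y≈0⇒x≈y (*-cancelˡ-0 (norm-pos {q} 0<d) (trans
      (solve 8 (λ ax ay px py qx qy t μ →
        let d = λ x y → (:- ax :* x :+ :- ay :* y) :+ (ax :* ax :+ ay :* ay)
            l = λ x y → (:- ay :* x :+ ax :* y) :+ con (+ 0) in
        (ax :* ax :+ ay :* ay) :* (py :- (ay :+ t :* (qy :- ay))) :=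
        ay :* (d qx qy :* t :- d px py) :+ :- ax :* ((l qx qy :- μ :* d qx qy) :* t :+ (μ :* (d qx qy :* t :- d px py) :- (l px py :- μ :* d px py))))
        refl ax ay (proj₁ p) (proj₂ p) (proj₁ q) (proj₂ q) t μ)
      (rest ay (- ax))))

-- Balanced configurations and the splitting ray.

module Induction {c ℓ : Level} (K : OrderedField c ℓ) {n : ℕ} (A B : Fin n → Plane.Point K)
  (pos-injective : ∀ {u v} → Plane._≈P_ K (Plane.Config.pos K A B u) (Plane.Config.pos K A B v) → u ≡ v)
  (atMostThree : Plane.Config.AtMostThreeOnABLines K A B) where
  open OrderedField K
  open OrderedFieldProperties K
  open IntegerCoefficients commutativeRing
  open Plane K
  open PlaneGeometry K
  open Config A B
  open PlaneGraphs K A B pos-injective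

  charge : Bool → Bool → ℤ
  charge true  true  = -[1+ 0 ]
  charge true  false = + 1
  charge false true  = + 1
  charge false false = -[1+ 0 ]

  charge-same : ∀ {s t} → s ≡ t → charge s t ≡ -[1+ 0 ]
  charge-same {true}  ≡.refl = ≡.refl
  charge-same {false} ≡.refl = ≡.refl

  charge-opposite : ∀ {s t} → s ≢ t → charge s t ≡ + 1
  charge-opposite {true}  {true}  ≢ = ⊥-elim (≢ ≡.refl)
  charge-opposite {true}  {false} ≢ = ≡.refl
  charge-opposite {false} {true}  ≢ = ≡.refl
  charge-opposite {false} {false} ≢ = ⊥-elim (≢ ≡.refl)

  opposite-unique : ∀ {s t u : Bool} → s ≢ t → s ≢ u → u ≡ t
  opposite-unique {true}  {true}  {_}     p q = ⊥-elim (p ≡.refl)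
  opposite-unique {true}  {false} {true}  p q = ⊥-elim (q ≡.refl)
  opposite-unique {true}  {false} {false} p q = ≡.refl
  opposite-unique {false} {false} {_}     p q = ⊥-elim (p ≡.refl)
  opposite-unique {false} {true}  {false} p q = ⊥-elim (q ≡.refl)
  opposite-unique {false} {true}  {true}  p q = ≡.refl

  weight : Bool → Vertex → ℤ
  weight s v = charge s (side v)

  total : Bool → List Vertex → ℤ
  total s = Weighted.total (weight s)

  total-neg : ∀ S → total false S ≡ ℤ.- total true S
  total-neg [] = ≡.refl
  total-neg (v ∷ S) with side v
  ... | true  = ≡.trans (≡.cong (λ t → + 1 ℤ.+ t) (total-neg S)) (≡.sym (ℤₚ.neg-distrib-+ -[1+ 0 ] (total true S)))
  ... | false = ≡.trans (≡.cong (λ t → -[1+ 0 ] ℤ.+ t) (total-neg S)) (≡.sym (ℤₚ.neg-distrib-+ (+ 1) (total true S)))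

  -- Demanded for both colours, since the next extreme vertex may have either one; by `total-neg`
  -- one of the two conditions implies the other.
  Balanced : List Vertex → Set
  Balanced S = ∀ s → total s S ≡ + 0

  balanced : ∀ s S → total s S ≡ + 0 → Balanced S
  balanced true  S e true  = e
  balanced true  S e false = ≡.trans (total-neg S) (≡.cong ℤ.-_ e)
  balanced false S e true  = ≡.trans (≡.sym (ℤₚ.neg-involutive _)) (≡.cong ℤ.-_ (≡.trans (≡.sym (total-neg S)) e))
  balanced false S e false = e

  ¬fourOnLine : ∀ {a b v₁ v₂ v₃ v₄} → side a ≢ side b →
    v₁ ≢ v₂ → v₁ ≢ v₃ → v₁ ≢ v₄ → v₂ ≢ v₃ → v₂ ≢ v₄ → v₃ ≢ v₄ →
    (∀ {v} → v ∈ (v₁ ∷ v₂ ∷ v₃ ∷ v₄ ∷ []) → OnLine (pos v) (pos a) (pos b)) → ⊥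
  ¬fourOnLine {inj₁ i} {inj₁ j} a≢b _ _ _ _ _ _ on = a≢b ≡.refl
  ¬fourOnLine {inj₁ i} {inj₂ j} a≢b p q r s t u on = atMostThree i j _ _ _ _ p q r s t u
    (on (here ≡.refl)) (on (there (here ≡.refl))) (on (there (there (here ≡.refl)))) (on (there (there (there (here ≡.refl)))))
  ¬fourOnLine {inj₂ j} {inj₁ i} a≢b p q r s t u on = atMostThree i j _ _ _ _ p q r s t u
    (OnLine-sym (on (here ≡.refl))) (OnLine-sym (on (there (here ≡.refl)))) (OnLine-sym (on (there (there (here ≡.refl))))) (OnLine-sym (on (there (there (there (here ≡.refl))))))
  ¬fourOnLine {inj₂ i} {inj₂ j} a≢b _ _ _ _ _ _ on = a≢b ≡.refl

  -- The line `ab` has room for one vertex besides `a` and `b`.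
  data AtMostOne : List Vertex → Set where
    none : AtMostOne []
    one  : ∀ v → AtMostOne (v ∷ [])

  -- `X` is the open side whose part receives `E`, whichever side of the ray that is. The charges of
  -- `a` and `b` cancel, so balance is asked of the remaining vertices. `h` grows along the ray and
  -- serves to build a supporting line through `b′`.
  record Splitting (S : List Vertex) : Set (c ⊔ ℓ) where
    field
      a b       : Vertex
      E X Y     : List Vertex
      perm      : S ↭ a ∷ b ∷ E ++ X ++ Y
      a≢b       : side a ≢ side b
      E-short   : AtMostOne E
      beyond    : All (Beyond a b) E
      f h       : Point → Carrier
      f-affine  : IsAffine f
      h-affine  : IsAffine h
      fa        : f (pos a) ≈ 0#
      fb        : f (pos b) ≈ 0#
      fE        : All (λ v → f (pos v) ≈ 0#) E
      ha        : h (pos a) ≈ 0#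
      hb        : 0# < h (pos b)
      hE        : All (λ v → h (pos b) < h (pos v)) E
      X>0       : All (λ v → 0# < f (pos v)) X
      Y<0       : All (λ v → f (pos v) < 0#) Y
      EX-bal    : total (side a) (E ++ X) ≡ + 0
      Y-bal     : total (side a) Y ≡ + 0

  ≤0∧1≤+1 : ∀ L → L ℤ.≤ + 0 → + 1 ℤ.≤ L ℤ.+ + 1 → L ≡ + 0
  ≤0∧1≤+1 (+ zero)       _ _ = ≡.refl
  ≤0∧1≤+1 (+ suc n)      (ℤ.+≤+ ()) _
  ≤0∧1≤+1 -[1+ zero ]    _ (ℤ.+≤+ ())
  ≤0∧1≤+1 -[1+ suc n ]   _ ()

  -- A jump by two passes from at most 0 to at least 1 only when it starts at 0 or -1; these are the
  -- two possibilities for placing `b′`.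
  ≤0∧1≤+2 : ∀ L → L ℤ.≤ + 0 → + 1 ℤ.≤ L ℤ.+ + 2 → L ≡ + 0 ⊎ L ≡ -[1+ 0 ]
  ≤0∧1≤+2 (+ zero)            _ _ = inj₁ ≡.refl
  ≤0∧1≤+2 (+ suc n)           (ℤ.+≤+ ()) _
  ≤0∧1≤+2 -[1+ zero ]         _ _ = inj₂ ≡.refl
  ≤0∧1≤+2 -[1+ suc zero ]     _ (ℤ.+≤+ ())
  ≤0∧1≤+2 -[1+ suc (suc n) ]  _ ()

  pred-injective : ∀ {i j} → + 1 ℤ.+ i ≡ + 1 ℤ.+ j → i ≡ j
  pred-injective {i} {j} e = ≡.trans (≡.sym (ℤₚ.pred-suc i)) (≡.trans (≡.cong ℤ.pred e) (ℤₚ.pred-suc j))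

  -1+i≡0 : ∀ {i} → -[1+ 0 ] ℤ.+ i ≡ + 0 → i ≡ + 1
  -1+i≡0 {i} e = ≡.trans (≡.sym (ℤₚ.suc-pred i)) (≡.cong ℤ.suc e)

  -- Supplies the second colour on a crowded ray, so that its line is an `AB`-line and the bound of
  -- three applies.
  opposite-exists : ∀ s Z → total s Z ℤ.≤ + 0 ⊎ (Σ Vertex λ v → v ∈ Z × s ≢ side v)
  opposite-exists s [] = inj₁ (ℤ.+≤+ ℕ.z≤n)
  opposite-exists s (v ∷ Z) with s Bool.≟ side v | opposite-exists s Z
  ... | no ≢    | _ = inj₂ (v , here ≡.refl , ≢)
  ... | yes _   | inj₂ (u , u∈ , ≢) = inj₂ (u , there u∈ , ≢)
  ... | yes eq  | inj₁ le = inj₁ (≡.subst (λ w → w ℤ.+ total s Z ℤ.≤ + 0) (≡.sym (charge-same eq)) (ℤₚ.+-mono-≤ {x = -[1+ 0 ]} {y = + 0} ℤ.-≤+ le))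

  module SplitAt (a : Vertex) (Q : List Vertex) (unique : Unique (a ∷ Q))
                 (extreme : ∀ {v} → v ∈ Q → norm² (pos v) ≤ norm² (pos a))
                 (Q-total : total (side a) Q ≡ + 1) where
    open ExtremePoint K (pos a)

    -- Up to orientation, the tangent of the angle between the ray to `v` and the direction `- a`.
    -- As `depth` is positive, its order is the angular order about `a`.
    slope : Vertex → Carrier
    slope v = lateral (pos v) * recip (depth (pos v))

    open Sweep K slope

    a∉Q : ∀ {v} → v ∈ Q → a ≢ v
    a∉Q v∈ = All.lookup (AllPairs.head unique) v∈

    depth>0 : ∀ {v} → v ∈ Q → 0# < depth (pos v)
    depth>0 v∈ = depth-pos (extreme v∈) (λ v≈a → a∉Q v∈ (≡.sym (pos-injective v≈a)))

    lateral-slope : ∀ {v μ} → v ∈ Q → slope v ≈ μ → lateral (pos v) ≈ (μ * depth (pos v))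
    lateral-slope {v} v∈ e = trans (sym (*-recip-cancel _ (depth>0 v∈))) (trans (*-comm _ _) (*-congʳ e))

    -- An equation of the line through `a` of slope `μ`; the factor `1#` and the summand `0#` match
    -- the shape of `affine-comb`.
    offset : Carrier → Point → Carrier
    offset μ p = (1# * lateral p + (- μ) * depth p) + 0#

    offset-affine : ∀ μ → IsAffine (offset μ)
    offset-affine μ = affine-comb 1# (- μ) 0# lateral-affine depth-affine

    offset-a : ∀ μ → offset μ (pos a) ≈ 0#
    offset-a μ = trans (+-congʳ (+-cong (*-congˡ lateral-a) (*-congˡ depth-a)))
      (solve 1 (λ μ → (con (+ 1) :* con (+ 0) :+ :- μ :* con (+ 0)) :+ con (+ 0) := con (+ 0)) refl μ)

    offset-slope : ∀ μ {v} → v ∈ Q → offset μ (pos v) ≈ (depth (pos v) * (slope v - μ))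
    offset-slope μ {v} v∈ = trans (+-congʳ (+-congʳ (*-congˡ (lateral-slope v∈ refl))))
      (solve 3 (λ s μ d → (con (+ 1) :* (s :* d) :+ :- μ :* d) :+ con (+ 0) := d :* (s :- μ)) refl (slope v) μ (depth (pos v)))

    offset-pos : ∀ {μ v} → v ∈ Q → μ < slope v → 0# < offset μ (pos v)
    offset-pos v∈ lt = <-respʳ (sym (offset-slope _ v∈)) (*-pos (depth>0 v∈) (0<y-x lt))

    offset-zero : ∀ {μ v} → v ∈ Q → slope v ≈ μ → offset μ (pos v) ≈ 0#
    offset-zero v∈ eq = trans (offset-slope _ v∈) (trans (*-congˡ (trans (+-congʳ eq) (-‿inverseʳ _))) (zeroʳ _))

    offset-neg : ∀ {μ v} → v ∈ Q → slope v < μ → offset μ (pos v) < 0#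
    offset-neg v∈ lt = <-respˡ (sym (offset-slope _ v∈)) (<-respʳ (zeroʳ _) (*-monoˡ-< (depth>0 v∈)
      (<-respʳ (-‿inverseʳ _) (+-mono-< _ lt))))

    module _ {μ : Carrier} where

      on-common-ray : ∀ {u v t} → u ∈ Q → v ∈ Q → slope u ≈ μ → slope v ≈ μ →
                      (depth (pos v) * t) ≈ depth (pos u) → pos u ≈P interp (pos a) (pos v) t
      on-common-ray {u} {v} {t} u∈ v∈ su sv dt =
        on-ray {pos u} {pos v} {t} {μ} (depth>0 v∈) (lateral-slope u∈ su) (lateral-slope v∈ sv) dt

      onLine : ∀ {u v} → u ∈ Q → v ∈ Q → slope u ≈ μ → slope v ≈ μ → OnLine (pos u) (pos a) (pos v)
      onLine u∈ v∈ su sv = _ , on-common-ray u∈ v∈ su sv (*-recip-cancel _ (depth>0 v∈))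

      depth-injective : ∀ {u v} → u ∈ Q → v ∈ Q → slope u ≈ μ → slope v ≈ μ → depth (pos u) ≈ depth (pos v) → u ≡ v
      depth-injective u∈ v∈ su sv eq = pos-injective (≈P-trans
        (on-common-ray u∈ v∈ su sv (trans (*-identityʳ _) (sym eq))) (interp-1 _ _ refl))

      between : ∀ {u v} → u ∈ Q → v ∈ Q → slope u ≈ μ → slope v ≈ μ → depth (pos u) < depth (pos v) →
                InOpenSeg (pos u) (pos a) (pos v)
      between {u} {v} u∈ v∈ su sv lt = t ,
        *-pos (depth>0 u∈) (recip-pos (depth>0 v∈)) ,
        *-cancelˡ-< (depth>0 v∈) (<-respˡ (sym dt) (<-respʳ (sym (*-identityʳ _)) lt)) ,
        on-common-ray u∈ v∈ su sv dt
        where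
        -- Along a ray from `a`, `depth` is proportional to the interpolation parameter, which is
        -- therefore a ratio of depths.
        t = depth (pos u) * recip (depth (pos v))
        dt = *-recip-cancel (depth (pos u)) (depth>0 v∈)

    module _ (critical : CriticalLevel (weight (side a)) Q) where
      open CriticalLevel critical
      open Weighted (weight (side a)) using (total-++; total-↭)

      private
        μ = slope pivot
        s = side a

        X⊆Q : ∀ {v} → v ∈ X → v ∈ Q
        X⊆Q v∈ = ∈-resp-↭ (↭-sym perm) (∈-++⁺ˡ v∈)

        Z⊆Q : ∀ {v} → v ∈ Z → v ∈ Q
        Z⊆Q v∈ = ∈-resp-↭ (↭-sym perm) (∈-++⁺ʳ X (∈-++⁺ˡ v∈))

        Y⊆Q : ∀ {v} → v ∈ Y → v ∈ Q
        Y⊆Q v∈ = ∈-resp-↭ (↭-sym perm) (∈-++⁺ʳ X (∈-++⁺ʳ Z v∈))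

        Z-slope : ∀ {v} → v ∈ Z → slope v ≈ μ
        Z-slope = All.lookup at

        Z-unique : Unique Z
        Z-unique with Unique-resp-↭ (↭-prep a perm) unique
        ... | _ ∷ u = Unique-++⁻ˡ Z (Unique-++⁻ʳ X u)

        Z≰0 : total s Z ℤ.≤ + 0 → ⊥
        Z≰0 Z≤0 with ℤₚ.≤-trans 1≤X+Z (ℤₚ.+-mono-≤ X≤0 Z≤0)
        ... | ℤ.+≤+ ()

        totals : total s X ℤ.+ (total s Z ℤ.+ total s Y) ≡ + 1
        totals = ≡.trans (≡.sym (≡.trans (total-++ X (Z ++ Y)) (≡.cong (λ t → total s X ℤ.+ t) (total-++ Z Y))))
                   (≡.trans (≡.sym (total-↭ perm)) Q-total)

      -- If the lower side is balanced by itself, `E` goes with the upper side; if it has total -1,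
      -- `E` repairs this deficit. The sign of `offset` is chosen to make the side receiving `E`
      -- positive.
      splitting : ∀ {S} → S ↭ a ∷ Q → ∀ b E → Z ↭ b ∷ E → s ≢ side b → AtMostOne E →
                  All (λ v → side v ≡ side b × depth (pos b) < depth (pos v)) E →
                  total s X ≡ + 0 ⊎ (total s X ≡ -[1+ 0 ] × total s E ≡ + 1) → Splitting S
      splitting {S} S↭ b E Z↭ s≢b E-short E-far = λ
        { (inj₁ X≡0) → record
            { a = a ; b = b ; E = E ; a≢b = s≢b ; E-short = E-short ; beyond = E-beyond
            ; h = depth ; h-affine = depth-affine ; ha = depth-a ; hb = depth>0 (Z⊆Q b∈) ; hE = All.map proj₂ E-far
            ; X = Y ; Y = X
            ; perm = ↭-trans S↭ (↭-prep a (↭-trans perm (↭-trans (++-comm X (Z ++ Y))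
                       (↭-trans (↭-reflexive (Listₚ.++-assoc Z Y X)) (++⁺ʳ (Y ++ X) Z↭)))))
            ; f = offset μ
            ; f-affine = offset-affine μ
            ; fa = offset-a μ
            ; fb = offset-zero (Z⊆Q b∈) (Z-slope b∈)
            ; fE = All.tabulate (λ v∈ → offset-zero (Z⊆Q (E⊆Z v∈)) (Z-slope (E⊆Z v∈)))
            ; X>0 = All.tabulate (λ v∈ → offset-pos (Y⊆Q v∈) (All.lookup above v∈))
            ; Y<0 = All.tabulate (λ v∈ → offset-neg (X⊆Q v∈) (All.lookup below v∈))
            ; EX-bal = ≡.trans (total-++ E Y) (pred-injective (≡.trans (≡.sym (ℤₚ.+-assoc (+ 1) (total s E) (total s Y)))
                (≡.trans (≡.cong (ℤ._+ total s Y) (≡.sym Z-total)) (≡.trans (≡.sym (ℤₚ.+-identityˡ _))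
                  (≡.trans (≡.cong (ℤ._+ (total s Z ℤ.+ total s Y)) (≡.sym X≡0)) totals)))))
            ; Y-bal = X≡0
            }
        ; (inj₂ (X≡-1 , E≡1)) → record
            { a = a ; b = b ; E = E ; a≢b = s≢b ; E-short = E-short ; beyond = E-beyond
            ; h = depth ; h-affine = depth-affine ; ha = depth-a ; hb = depth>0 (Z⊆Q b∈) ; hE = All.map proj₂ E-far
            ; X = X ; Y = Y
            ; perm = ↭-trans S↭ (↭-prep a (↭-trans perm (↭-trans (shifts X Z) (++⁺ʳ (X ++ Y) Z↭))))
            ; f = λ p → - offset μ p
            ; f-affine = affine-neg (offset-affine μ)
            ; fa = x≈0⇒-x≈0 (offset-a μ)
            ; fb = x≈0⇒-x≈0 (offset-zero (Z⊆Q b∈) (Z-slope b∈))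
            ; fE = All.tabulate (λ v∈ → x≈0⇒-x≈0 (offset-zero (Z⊆Q (E⊆Z v∈)) (Z-slope (E⊆Z v∈))))
            ; X>0 = All.tabulate (λ v∈ → 0<-x (offset-neg (X⊆Q v∈) (All.lookup below v∈)))
            ; Y<0 = All.tabulate (λ v∈ → -x<0 (offset-pos (Y⊆Q v∈) (All.lookup above v∈)))
            ; EX-bal = ≡.trans (total-++ E X) (≡.cong₂ ℤ._+_ E≡1 X≡-1)
            ; Y-bal = pred-injective (pred-1 {total s Y} (≡.trans (≡.sym (≡.cong₂ (λ x z → x ℤ.+ (z ℤ.+ total s Y)) X≡-1
                        (≡.trans Z-total (≡.cong (λ t → + 1 ℤ.+ t) E≡1)))) totals))
            } }
        where
        E⊆Z : ∀ {v} → v ∈ E → v ∈ Z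
        E⊆Z v∈ = ∈-resp-↭ (↭-sym Z↭) (there v∈)

        b∈ : b ∈ Z
        b∈ = ∈-resp-↭ (↭-sym Z↭) (here ≡.refl)

        Z-total : total s Z ≡ + 1 ℤ.+ total s E
        Z-total = ≡.trans (total-↭ Z↭) (≡.cong (ℤ._+ total s E) (charge-opposite s≢b))

        pred-1 : ∀ {i} → -[1+ 0 ] ℤ.+ (+ 2 ℤ.+ i) ≡ + 1 → + 1 ℤ.+ i ≡ + 1
        pred-1 {i} e = ≡.trans (ℤₚ.+-assoc -[1+ 0 ] (+ 2) i) e

        E-beyond : All (Beyond a b) E
        E-beyond = All.tabulate λ v∈ → proj₁ (All.lookup E-far v∈) ,
          between (Z⊆Q b∈) (Z⊆Q (E⊆Z v∈)) (Z-slope b∈) (Z-slope (E⊆Z v∈)) (proj₂ (All.lookup E-far v∈))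

      private
        charge-total-1 : ∀ {b} → s ≢ side b → total s (b ∷ []) ≡ + 1
        charge-total-1 ≢ = ≡.cong (ℤ._+ + 0) (charge-opposite ≢)

        onLine-a : ∀ {b} → OnLine (pos a) (pos a) (pos b)
        onLine-a {b} = 0# , ≈P-sym (interp-0 (pos a) (pos b) refl)

      splitting-exists : ∀ {S} → S ↭ a ∷ Q → Splitting S
      splitting-exists {S} S↭ = classify Z ≡.refl
        where
        distinct-pair : ∀ b b′ → Z ≡ b ∷ b′ ∷ [] → s ≢ side b → s ≢ side b′ →
                        total s X ≡ + 0 ⊎ (total s X ≡ -[1+ 0 ]) → Splitting S
        distinct-pair b b′ eq s≢b s≢b′ X-total
          with compare (depth (pos b)) (depth (pos b′))
        ... | tri< lt _ _ = splitting S↭ b (b′ ∷ []) (↭-reflexive eq) s≢b (one b′) ((opposite-unique s≢b s≢b′ , lt) ∷ [])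
                              ([ inj₁ , (λ e → inj₂ (e , charge-total-1 {b′} s≢b′)) ]′ X-total)
        ... | tri> _ _ gt = splitting S↭ b′ (b ∷ []) (↭-trans (↭-reflexive eq) (Perm.swap b b′ ↭-refl)) s≢b′ (one b) ((opposite-unique s≢b′ s≢b , gt) ∷ [])
                              ([ inj₁ , (λ e → inj₂ (e , charge-total-1 {b} s≢b)) ]′ X-total)
        ... | tri≈ _ same-depth _ with ≡.subst Unique eq Z-unique
        ...   | (b≢b′ ∷ _) ∷ _ = ⊥-elim (b≢b′ (depth-injective (Z⊆Q b∈) (Z⊆Q b′∈) (Z-slope b∈) (Z-slope b′∈) same-depth))
          where
          b∈ : b ∈ Z
          b∈ = ≡.subst (b ∈_) (≡.sym eq) (here ≡.refl)
          b′∈ : b′ ∈ Z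
          b′∈ = ≡.subst (b′ ∈_) (≡.sym eq) (there (here ≡.refl))

        classify : ∀ Z′ → Z ≡ Z′ → Splitting S
        classify [] eq = ⊥-elim (Z≰0 (ℤₚ.≤-reflexive (≡.cong (total s) eq)))
        classify (b ∷ []) eq with s Bool.≟ side b
        ... | yes s≡b = ⊥-elim (Z≰0 (≡.subst (ℤ._≤ + 0)
                          (≡.sym (≡.trans (≡.cong (total s) eq) (≡.cong (ℤ._+ + 0) (charge-same s≡b)))) ℤ.-≤+))
        ... | no  s≢b = splitting S↭ b [] (↭-reflexive eq) s≢b none [] (inj₁ (≤0∧1≤+1 _ X≤0
                          (≡.subst (λ t → + 1 ℤ.≤ total s X ℤ.+ t) (≡.trans (≡.cong (total s) eq) (charge-total-1 {b} s≢b)) 1≤X+Z)))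
        -- Two vertices of the colour of `a` contribute -2 and a mixed pair 0, so only two vertices
        -- of the opposite colour can lift the sum.
        classify (b ∷ b′ ∷ []) eq with s Bool.≟ side b | s Bool.≟ side b′
        ... | yes p | yes q = ⊥-elim (Z≰0 (≡.subst (ℤ._≤ + 0) (≡.sym (≡.trans (≡.cong (total s) eq)
                                (≡.cong₂ (λ x y → x ℤ.+ (y ℤ.+ + 0)) (charge-same p) (charge-same q)))) ℤ.-≤+))
        ... | yes p | no q  = ⊥-elim (Z≰0 (ℤₚ.≤-reflexive (≡.trans (≡.cong (total s) eq)
                                (≡.cong₂ (λ x y → x ℤ.+ (y ℤ.+ + 0)) (charge-same p) (charge-opposite q)))))
        ... | no p  | yes q = ⊥-elim (Z≰0 (ℤₚ.≤-reflexive (≡.trans (≡.cong (total s) eq)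
                                (≡.cong₂ (λ x y → x ℤ.+ (y ℤ.+ + 0)) (charge-opposite p) (charge-same q)))))
        ... | no p  | no q  = distinct-pair b b′ eq p q (≤0∧1≤+2 _ X≤0 (≡.subst (λ t → + 1 ℤ.≤ total s X ℤ.+ t)
                                (≡.trans (≡.cong (total s) eq) (≡.cong₂ (λ x y → x ℤ.+ (y ℤ.+ + 0)) (charge-opposite p) (charge-opposite q))) 1≤X+Z))
        -- Together with `a`, three vertices of the ray make four on the line through `a` and some
        -- `b` of the opposite colour.
        classify (z₁ ∷ z₂ ∷ z₃ ∷ Z′) eq with opposite-exists s Z
        ... | inj₁ Z≤0 = ⊥-elim (Z≰0 Z≤0)
        ... | inj₂ (b , b∈ , s≢b) with ≡.subst Unique eq Z-unique
        ...   | (z₁≢z₂ ∷ z₁≢z₃ ∷ _) ∷ (z₂≢z₃ ∷ _) ∷ _ = ⊥-elim (¬fourOnLine s≢b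
                  (a∉Q (Z⊆Q (in-Z (here ≡.refl)))) (a∉Q (Z⊆Q (in-Z (there (here ≡.refl))))) (a∉Q (Z⊆Q (in-Z (there (there (here ≡.refl))))))
                  z₁≢z₂ z₁≢z₃ z₂≢z₃ λ
                  { (here ≡.refl) → onLine-a {b}
                  ; (there (here ≡.refl)) → on (here ≡.refl)
                  ; (there (there (here ≡.refl))) → on (there (here ≡.refl))
                  ; (there (there (there (here ≡.refl)))) → on (there (there (here ≡.refl))) })
          where
          in-Z : ∀ {v} → v ∈ (z₁ ∷ z₂ ∷ z₃ ∷ Z′) → v ∈ Z
          in-Z {v} = ≡.subst (v ∈_) (≡.sym eq)
          on : ∀ {v} → v ∈ (z₁ ∷ z₂ ∷ z₃ ∷ Z′) → OnLine (pos v) (pos a) (pos b)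
          on v∈ = onLine (Z⊆Q (in-Z v∈)) (Z⊆Q b∈) (Z-slope (in-Z v∈)) (Z-slope b∈)

-- The induction on the number of vertices.

module Trees {c ℓ : Level} (K : OrderedField c ℓ) {n : ℕ} (A B : Fin n → Plane.Point K)
  (pos-injective : ∀ {u v} → Plane._≈P_ K (Plane.Config.pos K A B u) (Plane.Config.pos K A B v) → u ≡ v)
  (atMostThree : Plane.Config.AtMostThreeOnABLines K A B) where
  open OrderedField K
  open OrderedFieldProperties K
  open IntegerCoefficients commutativeRing
  open Plane K
  open PlaneGeometry K
  open Config A B
  open PlaneGraphs K A B pos-injective
  open Induction K A B pos-injective atMostThree

  module _ {a b E X f h} (a≢b : side a ≢ side b) (beyond : All (Beyond a b) E) (F : IsAffine f) (H : IsAffine h)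
           (fa : f (pos a) ≈ 0#) (fb : f (pos b) ≈ 0#) (fE : All (λ v → f (pos v) ≈ 0#) E)
           (ha : h (pos a) ≈ 0#) (hb : 0# < h (pos b)) (hE : All (λ v → h (pos b) < h (pos v)) E)
           (X>0 : All (λ v → 0# < f (pos v)) X) where
    open Along a≢b beyond F fa fb fE

    -- Produces the supporting line that `attach` asks for. When `E` is empty, a parallel to `ab`
    -- serves; otherwise such a parallel would leave `e`, where `f` vanishes, on the side of `a` and
    -- `b`.
    attach-to-hull : ∀ {x} → x ∈ X → AtMostOne E → ConnectedPlaneGraph (E ++ X) → ConnectedPlaneGraph (a ∷ b ∷ E ++ X)
    attach-to-hull x∈ none G = lowest X ≡.refl x∈
      where
      lowest : ∀ X′ → X ≡ X′ → _ ∈ X′ → ConnectedPlaneGraph (a ∷ b ∷ X)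
      lowest (x ∷ xs) ≡.refl _ with Sweep.maximum K (λ v → - f (pos v)) x xs
      ... | c , c∈ , max = attach F X>0 c∈ (below fa) (below fb) (λ v∈ → neg-cancel-≤ (max v∈)) G
        where
        below : ∀ {y} → y ≈ 0# → y < f (pos c)
        below y≈0 = <-respˡ (sym y≈0) (All.lookup X>0 c∈)
    -- The supporting line of X through the point e beyond b separates a and b from X.
    attach-to-hull x∈ (one e) G = steepest X ≡.refl x∈
      where
      -- A line through `e` given by `μ * f + h - h (pos e)` has `v` on its nonnegative side exactly
      -- when `μ` is at least this quotient. Hence the maximal quotient gives the line that supports
      -- `X`.
      ratio : Vertex → Carrier
      ratio v = (h (pos e) - h (pos v)) * recip (f (pos v))

      steepest : ∀ X′ → X ≡ X′ → _ ∈ X′ → ConnectedPlaneGraph (a ∷ b ∷ e ∷ X)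
      steepest (x ∷ xs) ≡.refl _ with Sweep.maximum K ratio x xs
      ... | c , c∈ , max = attach {g = g} (affine-comb μ 1# (- h (pos e)) F H) X>0 c∈
              (<-respʳ (sym g-c) (<-respˡ (sym (g-line fa)) (h<e (<-respˡ (sym ha) (<-trans hb be)))))
              (<-respʳ (sym g-c) (<-respˡ (sym (g-line fb)) (h<e be)))
              (λ v∈ → ≤-trans (≤-reflexive g-c) (g≥0 v∈)) G
        where
        μ = ratio c

        g : Point → Carrier
        g p = (μ * f p + 1# * h p) + (- h (pos e))

        be : h (pos b) < h (pos e)
        be = All.lookup hE (here ≡.refl)

        g-line : ∀ {p} → f p ≈ 0# → g p ≈ (h p - h (pos e))
        g-line {p} fp = trans (+-congʳ (+-congʳ (*-congˡ fp)))
          (solve 3 (λ μ hp he → (μ :* con (+ 0) :+ con (+ 1) :* hp) :- he := hp :- he) refl μ (h p) (h (pos e)))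

        h<e : ∀ {x} → x < h (pos e) → (x - h (pos e)) < 0#
        h<e lt = <-respʳ (-‿inverseʳ _) (+-mono-< _ lt)

        f-ratio : ∀ {v} → v ∈ X → (f (pos v) * ratio v) ≈ (h (pos e) - h (pos v))
        f-ratio v∈ = *-recip-cancel _ (All.lookup X>0 v∈)

        g-X : ∀ {v} → v ∈ X → g (pos v) ≈ (f (pos v) * (μ - ratio v))
        g-X {v} v∈ = trans (solve 4 (λ μ fv hv he → (μ :* fv :+ con (+ 1) :* hv) :- he := fv :* μ :- (he :- hv))
            refl μ (f (pos v)) (h (pos v)) (h (pos e)))
          (trans (+-congˡ (-‿cong (sym (f-ratio v∈))))
            (solve 3 (λ fv μ r → fv :* μ :- fv :* r := fv :* (μ :- r)) refl (f (pos v)) μ (ratio v)))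

        g-zero : ∀ {v} → v ∈ X → ratio v ≈ μ → g (pos v) ≈ 0#
        g-zero {v} v∈ eq = trans (g-X v∈) (trans (*-congˡ (trans (+-congˡ (-‿cong eq)) (-‿inverseʳ μ))) (zeroʳ _))

        g-c : g (pos c) ≈ 0#
        g-c = g-zero c∈ refl

        g≥0 : ∀ {v} → v ∈ (e ∷ X) → 0# ≤ g (pos v)
        g≥0 (here ≡.refl) = inj₂ (sym (trans (g-line (All.lookup fE (here ≡.refl))) (-‿inverseʳ _)))
        g≥0 (there v∈) with max v∈
        ... | inj₁ lt = inj₁ (<-respʳ (sym (g-X v∈)) (*-pos (All.lookup X>0 v∈) (0<y-x lt)))
        ... | inj₂ eq = inj₂ (sym (g-zero v∈ eq))

  empty-graph : ConnectedPlaneGraph []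
  empty-graph = record
    { edges = [] ; within = λ () ; bivisible = λ () ; connected = λ () ; nonCrossing = λ () }

  split : ∀ x S → Unique (x ∷ S) → Balanced (x ∷ S) → Splitting (x ∷ S)
  split x S unique bal with Sweep.maximum K (λ v → norm² (pos v)) x S
  ... | a , a∈ , max with extract a∈
  ...   | Q , perm = splitting-exists (Sweep.criticalLevel K slope (weight (side a)) (length Q) Q ℕₚ.≤-refl (ℤₚ.≤-reflexive (≡.sym Q-total))) perm
    where
    Q-total : total (side a) Q ≡ + 1
    Q-total = -1+i≡0 (≡.trans (≡.sym (≡.trans (Weighted.total-↭ (weight (side a)) perm)
                (≡.cong (ℤ._+ total (side a) Q) (charge-same {side a} ≡.refl)))) (bal (side a)))
    open SplitAt a Q (Unique-resp-↭ perm unique) (λ v∈ → max (∈-resp-↭ (↭-sym perm) (there v∈))) Q-total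

  assemble : ∀ {k S} → length S ℕ.≤ suc k → Unique S →
             (∀ S′ → length S′ ℕ.≤ k → Unique S′ → Balanced S′ → ConnectedPlaneGraph S′) →
             Splitting S → ConnectedPlaneGraph S
  assemble {k} {S} len unique IH splitting = resp-⊆⊇ (∈-resp-↭ (↭-sym perm)) (∈-resp-↭ perm)
    (cases E-short X Y perm beyond fE hE X>0 Y<0 EX-bal Y-bal)
    where
    open Splitting splitting

    -- The entry `r` witnesses that `P` omits a vertex of `S`, which makes the induction hypothesis
    -- available.
    sub : ∀ P {r R} → S ↭ P ++ r ∷ R → Balanced P → ConnectedPlaneGraph P
    sub P {r} {R} p = IH P (ℕₚ.≤-trans (ℕₚ.m≤m+n (length P) (length R)) (ℕₚ.≤-pred (ℕₚ.≤-trans (ℕₚ.≤-reflexive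
        (≡.trans (≡.sym (ℕₚ.+-suc (length P) (length R))) (≡.sym (≡.trans (↭-length p) (Listₚ.length-++ P))))) len)))
      (Unique-++⁻ˡ P (Unique-resp-↭ p unique))

    with-ab : ∀ L → total (side a) L ≡ + 0 → Balanced (a ∷ b ∷ L)
    with-ab L e = balanced (side a) (a ∷ b ∷ L) (≡.trans
      (≡.cong₂ (λ p q → p ℤ.+ (q ℤ.+ total (side a) L)) (charge-same {side a} ≡.refl) (charge-opposite a≢b))
      (≡.cong (λ t → -[1+ 0 ] ℤ.+ (+ 1 ℤ.+ t)) e))

    cases : ∀ {E} → AtMostOne E → ∀ X Y → S ↭ a ∷ b ∷ E ++ X ++ Y → All (Beyond a b) E →
            All (λ v → f (pos v) ≈ 0#) E → All (λ v → h (pos b) < h (pos v)) E →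
            All (λ v → 0# < f (pos v)) X → All (λ v → f (pos v) < 0#) Y →
            total (side a) (E ++ X) ≡ + 0 → total (side a) Y ≡ + 0 → ConnectedPlaneGraph (a ∷ b ∷ E ++ X ++ Y)
    -- A vertex `b′` alone on its part would give total 1 instead of 0.
    cases (one e) [] Y p ((e≡b , _) ∷ []) fE hE X>0 Y<0 EX-bal Y-bal
      with ≡.trans (≡.sym EX-bal) (≡.cong (ℤ._+ + 0) (charge-opposite (λ q → a≢b (≡.trans q e≡b))))
    ... | ()
    cases none [] [] p bey fE hE X>0 Y<0 EX-bal Y-bal = single-edge a≢b
    -- The remaining vertices are on the negative side, so the line is described by `- f`.
    cases none [] (y ∷ ys) p bey fE hE X>0 Y<0 EX-bal Y-bal =
      attach-to-hull {f = λ q → - f q} {h = h} a≢b [] (affine-neg f-affine) h-affine (x≈0⇒-x≈0 fa) (x≈0⇒-x≈0 fb) [] ha hb []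
        (All.map 0<-x Y<0) (here ≡.refl) none
        (sub (y ∷ ys) (↭-trans p (++-comm (a ∷ b ∷ []) (y ∷ ys))) (balanced (side a) (y ∷ ys) Y-bal))
    cases {E} short (x ∷ xs) [] p bey fE hE X>0 Y<0 EX-bal Y-bal =
      ≡.subst ConnectedPlaneGraph (≡.cong (λ l → a ∷ b ∷ E ++ l) (≡.sym (Listₚ.++-identityʳ (x ∷ xs))))
        (attach-to-hull {f = f} {h = h} a≢b bey f-affine h-affine fa fb fE ha hb hE X>0 (here ≡.refl) short
          (sub (E ++ x ∷ xs) (↭-trans p (↭-trans (↭-reflexive (≡.cong (λ l → a ∷ b ∷ E ++ l) (Listₚ.++-identityʳ (x ∷ xs))))
            (++-comm (a ∷ b ∷ []) (E ++ x ∷ xs)))) (balanced (side a) (E ++ x ∷ xs) EX-bal)))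
    cases {E} short X@(x ∷ xs) Y@(y ∷ ys) p bey fE hE X>0 Y<0 EX-bal Y-bal =
      merge X>0 Y<0
        (sub (a ∷ b ∷ E ++ X) (↭-trans p (↭-reflexive assoc)) (with-ab (E ++ X) EX-bal))
        (sub (a ∷ b ∷ Y) (↭-trans p (↭-trans (↭-reflexive assoc)
          (↭-prep a (↭-prep b (↭-trans (++-comm (E ++ X) Y) (++⁺ˡ Y (++-comm E X))))))) (with-ab Y Y-bal))
      where
      open Along a≢b bey f-affine fa fb fE
      assoc : a ∷ b ∷ E ++ X ++ Y ≡ a ∷ b ∷ (E ++ X) ++ Y
      assoc = ≡.cong (λ l → a ∷ b ∷ l) (≡.sym (Listₚ.++-assoc E X Y))

  -- The parts are not structural sublists of `S`, so the recursion runs on a bound `k` for the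
  -- length.
  connectedPlaneGraph : ∀ k S → length S ℕ.≤ k → Unique S → Balanced S → ConnectedPlaneGraph S
  connectedPlaneGraph _       []      _   _      _   = empty-graph
  connectedPlaneGraph (suc k) (x ∷ S) len unique bal = assemble len unique (connectedPlaneGraph k) (split x S unique bal)

-- Extracting a spanning tree.

module SpanningForest {c ℓ : Level} (K : OrderedField c ℓ) {n : ℕ} (A B : Fin n → Plane.Point K)
  (pos-injective : ∀ {u v} → Plane._≈P_ K (Plane.Config.pos K A B u) (Plane.Config.pos K A B v) → u ≡ v) where
  open Plane K
  open Config A B
  open PlaneGraphs K A B pos-injective

  -- Repeated passages of a walk over the edge `(i , j)` can be short-cut to at most one.
  Reach-split : ∀ {p q} {P : Edge → Set p} {Q : Edge → Set q} {i j} → (∀ {e} → Q e → P e ⊎ e ≡ (i , j)) →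
                ∀ {u v} → Reach Q u v →
                Reach P u v ⊎ (Reach P u (inj₁ i) × Reach P (inj₂ j) v) ⊎ (Reach P u (inj₂ j) × Reach P (inj₁ i) v)
  Reach-split cut here = inj₁ here
  Reach-split cut (stepᵃᵇ q r) with cut q | Reach-split cut r
  ... | inj₁ p      | inj₁ s               = inj₁ (stepᵃᵇ p s)
  ... | inj₁ p      | inj₂ (inj₁ (s , t))  = inj₂ (inj₁ (stepᵃᵇ p s , t))
  ... | inj₁ p      | inj₂ (inj₂ (s , t))  = inj₂ (inj₂ (stepᵃᵇ p s , t))
  ... | inj₂ ≡.refl | inj₁ s               = inj₂ (inj₁ (here , s))
  ... | inj₂ ≡.refl | inj₂ (inj₁ (_ , t))  = inj₂ (inj₁ (here , t))
  ... | inj₂ ≡.refl | inj₂ (inj₂ (_ , t))  = inj₁ t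
  Reach-split cut (stepᵇᵃ q r) with cut q | Reach-split cut r
  ... | inj₁ p      | inj₁ s               = inj₁ (stepᵇᵃ p s)
  ... | inj₁ p      | inj₂ (inj₁ (s , t))  = inj₂ (inj₁ (stepᵇᵃ p s , t))
  ... | inj₁ p      | inj₂ (inj₂ (s , t))  = inj₂ (inj₂ (stepᵇᵃ p s , t))
  ... | inj₂ ≡.refl | inj₁ s               = inj₂ (inj₂ (here , s))
  ... | inj₂ ≡.refl | inj₂ (inj₁ (_ , t))  = inj₁ t
  ... | inj₂ ≡.refl | inj₂ (inj₂ (_ , t))  = inj₂ (inj₂ (here , t))

  ∈-uncons : ∀ {e f : Edge} {T} → f ∈ (e ∷ T) → f ∈ T ⊎ f ≡ e
  ∈-uncons (here p)  = inj₂ p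
  ∈-uncons (there q) = inj₁ q

  reach? : ∀ T u v → Dec (Reach (_∈ T) u v)
  reach? [] u v = map′ (λ { ≡.refl → here }) (λ { here → ≡.refl ; (stepᵃᵇ () _) ; (stepᵇᵃ () _) })
                       (Sumₚ.≡-dec Fin._≟_ Fin._≟_ u v)
  reach? ((i , j) ∷ T) u v = map′
    (λ { (inj₁ r) → Reach-map there r
       ; (inj₂ (inj₁ (r , s))) → Reach-trans (Reach-map there r) (stepᵃᵇ (here ≡.refl) (Reach-map there s))
       ; (inj₂ (inj₂ (r , s))) → Reach-trans (Reach-map there r) (stepᵇᵃ (here ≡.refl) (Reach-map there s)) })
    (Reach-split ∈-uncons)
    (reach? T u v ⊎-dec ((reach? T u (inj₁ i) ×-dec reach? T (inj₂ j) v) ⊎-dec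
                         (reach? T u (inj₂ j) ×-dec reach? T (inj₁ i) v)))

  Acyclic : List Edge → Set
  Acyclic T = ∀ {i j} → (i , j) ∈ T → ¬ Reach (λ e → e ∈ T × e ≢ (i , j)) (inj₁ i) (inj₂ j)

  -- If the new edge closed a cycle through an old one, the rest of this cycle would already join
  -- `i` to `j` within `F`.
  acyclic-∷ : ∀ {i j F} → ¬ Reach (_∈ F) (inj₁ i) (inj₂ j) → Acyclic F → Acyclic ((i , j) ∷ F)
  acyclic-∷ {F = F} i≁j acyclic (here ≡.refl) r = i≁j (Reach-map (λ { (f∈ , f≢) → [ (λ p → p) , (λ e → ⊥-elim (f≢ e)) ]′ (∈-uncons f∈) }) r)
  acyclic-∷ {i} {j} {F} i≁j acyclic {k} {l} (there kl∈) r with Reach-split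
      {P = λ e → e ∈ F × e ≢ (k , l)} {i = i} {j = j}
      (λ { (f∈ , f≢) → [ (λ p → inj₁ (p , f≢)) , inj₂ ]′ (∈-uncons f∈) }) r
  ... | inj₁ s              = acyclic kl∈ s
  ... | inj₂ (inj₁ (s , t)) = i≁j (Reach-trans (Reach-sym (Reach-map proj₁ s)) (stepᵃᵇ kl∈ (Reach-sym (Reach-map proj₁ t))))
  ... | inj₂ (inj₂ (s , t)) = i≁j (Reach-trans (Reach-map proj₁ t) (stepᵇᵃ kl∈ (Reach-map proj₁ s)))

  -- The greedy choice of Kruskal's algorithm: an edge is kept only if the edges already kept do not
  -- join its ends.
  spanningForest : ∀ T → Σ (List Edge) λ F →
    (∀ {e} → e ∈ F → e ∈ T) × (∀ {u v} → Reach (_∈ T) u v → Reach (_∈ F) u v) × Acyclic F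
  spanningForest [] = [] , (λ e∈ → e∈) , (λ r → r) , λ ()
  spanningForest ((i , j) ∷ T) with spanningForest T
  ... | F , F⊆T , T⇒F , acyclic with reach? F (inj₁ i) (inj₂ j)
  ...   | no i≁j = (i , j) ∷ F ,
                   (λ { (here p) → here p ; (there e∈) → there (F⊆T e∈) }) ,
                   (λ r → back (Reach-split ∈-uncons r)) ,
                   acyclic-∷ i≁j acyclic
    where
    up : ∀ {u v} → Reach (_∈ T) u v → Reach (_∈ ((i , j) ∷ F)) u v
    up r = Reach-map there (T⇒F r)
    back : ∀ {u v} → Reach (_∈ T) u v ⊎ (Reach (_∈ T) u (inj₁ i) × Reach (_∈ T) (inj₂ j) v)
             ⊎ (Reach (_∈ T) u (inj₂ j) × Reach (_∈ T) (inj₁ i) v) → Reach (_∈ ((i , j) ∷ F)) u v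
    back (inj₁ r) = up r
    back (inj₂ (inj₁ (r , s))) = Reach-trans (up r) (stepᵃᵇ (here ≡.refl) (up s))
    back (inj₂ (inj₂ (r , s))) = Reach-trans (up r) (stepᵇᵃ (here ≡.refl) (up s))
  ...   | yes i~j = F , (λ e∈ → there (F⊆T e∈)) , (λ r → back (Reach-split ∈-uncons r)) , acyclic
    where
    back : ∀ {u v} → Reach (_∈ T) u v ⊎ (Reach (_∈ T) u (inj₁ i) × Reach (_∈ T) (inj₂ j) v)
             ⊎ (Reach (_∈ T) u (inj₂ j) × Reach (_∈ T) (inj₁ i) v) → Reach (_∈ F) u v
    back (inj₁ r) = T⇒F r
    back (inj₂ (inj₁ (r , s))) = Reach-trans (T⇒F r) (Reach-trans i~j (T⇒F s))
    back (inj₂ (inj₂ (r , s))) = Reach-trans (T⇒F r) (Reach-trans (Reach-sym i~j) (T⇒F s))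

-- Application to the list of all vertices.

theorem17 : {c ℓ : Level} (K : OrderedField c ℓ) → let open Plane K in
    (n : ℕ) (A B : Fin n → Point) → let open Config A B in
    Distinct → Disjoint → AtMostThreeOnABLines →
    Σ (List Edge) λ T → IsSpanningTree T × NonCrossing T
theorem17 K n A B (A-distinct , B-distinct) disjoint atMostThree =
  F ,
  ((λ e∈ v → bivisible (F⊆G e∈) (complete v)) , (λ u v → G⇒F (connected (complete u) (complete v))) , acyclic) ,
  λ e∈ f∈ → nonCrossing (F⊆G e∈) (F⊆G f∈)
  where
  open OrderedField K using (sym)
  open Plane K
  open Config A B

  pos-injective : ∀ {u v} → pos u ≈P pos v → u ≡ v
  pos-injective {inj₁ i} {inj₁ j} e = ≡.cong inj₁ (A-distinct i j e)
  pos-injective {inj₁ i} {inj₂ j} e = ⊥-elim (disjoint i j e)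
  pos-injective {inj₂ i} {inj₁ j} (x , y) = ⊥-elim (disjoint j i (sym x , sym y))
  pos-injective {inj₂ i} {inj₂ j} e = ≡.cong inj₂ (B-distinct i j e)

  open Induction K A B pos-injective atMostThree using (Balanced; total; weight; balanced)
  open Trees K A B pos-injective atMostThree using (connectedPlaneGraph)
  open SpanningForest K A B pos-injective using (spanningForest)
  open Weighted (weight true) using (total-++)

  vertices : List Vertex
  vertices = map inj₁ (allFin n) ++ map inj₂ (allFin n)

  complete : ∀ v → v ∈ vertices
  complete (inj₁ i) = ∈-++⁺ˡ (∈-map⁺ inj₁ (∈-allFin i))
  complete (inj₂ j) = ∈-++⁺ʳ (map inj₁ (allFin n)) (∈-map⁺ inj₂ (∈-allFin j))

  vertices-unique : Unique vertices
  vertices-unique = Uniqueₚ.++⁺ (Uniqueₚ.map⁺ Sumₚ.inj₁-injective (Uniqueₚ.allFin⁺ n))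
                                (Uniqueₚ.map⁺ Sumₚ.inj₂-injective (Uniqueₚ.allFin⁺ n)) colours-differ
    where
    colours-differ : ∀ {v} → ¬ (v ∈ map inj₁ (allFin n) × v ∈ map inj₂ (allFin n))
    colours-differ (v∈A , v∈B) with ∈-map⁻ inj₁ v∈A | ∈-map⁻ inj₂ v∈B
    ... | _ , _ , ≡.refl | _ , _ , ()

  vertices-balanced : Balanced vertices
  vertices-balanced = balanced true vertices (≡.trans (total-++ (map inj₁ (allFin n)) _)
    (≡.trans (≡.cong (ℤ._+ total true (map inj₂ (allFin n))) (opposite-totals (allFin n)))
             (ℤₚ.+-inverseˡ (total true (map inj₂ (allFin n))))))
    where
    opposite-totals : ∀ is → total true (map inj₁ is) ≡ ℤ.- total true (map inj₂ is)
    opposite-totals []       = ≡.refl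
    opposite-totals (i ∷ is) = ≡.trans (≡.cong (λ t → -[1+ 0 ] ℤ.+ t) (opposite-totals is))
                                       (≡.sym (ℤₚ.neg-distrib-+ (+ 1) (total true (map inj₂ is))))

  G = connectedPlaneGraph (length vertices) vertices ℕₚ.≤-refl vertices-unique vertices-balanced

  open PlaneGraphs.ConnectedPlaneGraph G

  forest = spanningForest edges
  F = proj₁ forest
  F⊆G = proj₁ (proj₂ forest)
  G⇒F = proj₁ (proj₂ (proj₂ forest))
  acyclic = proj₂ (proj₂ (proj₂ forest))
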